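{- (i) For any signed graph $(G,\sigma)$, if $G$ is planar and $(G,\sigma)$ is $2$-colorable, then $AT(G,\sigma)\le 4$. (ii) There exists a signed graph $(G,\sigma)$ with $G$ planar such that $(G,\sigma)$ is $2$-colorable but not $3$-choosable.
   Context: A signed graph $(G,\sigma)$ consists of a finite simple graph $G$ and a map $\sigma\colon E(G)\to\{+1,-1\}$. A proper coloring of $(G,\sigma)$ with color set $C\subset\mathbb{Z}$ is a map $\phi\colon V(G)\to C$ with $\phi(u)\neq\sigma(uv)\phi(v)$ for every edge $uv$. For $k\ge1$, $M_k=\{\pm1,\dots,\pm k/2\}$ if $k$ is even and $M_k=\{0,\pm1,\dots,\pm(k-1)/2\}$ if $k$ is odd; $(G,\sigma)$ is $k$-colorable if it has a proper coloring with color set $M_k$ (so $2$-colorable means a proper coloring with colors in $\{1,-1\}$). A $k$-list assignment assigns to each vertex $v$ a set $L(v)\subset\mathbb{Z}$ with $|L(v)|=k$; an $L$-coloring is a proper coloring $\phi$ with $\phi(v)\in L(v)$ for all $v$; $(G,\sigma)$ is $k$-choosable if it has an $L$-coloring for every $k$-list assignment $L$. Fix a linear ordering $<$ of $V(G)$; the graph polynomial is $P_{G,\sigma}(\mathbf{x})=\prod_{uv\in E(G),\,u<v}(x_u-\sigma(uv)x_v)$, and $AT(G,\sigma)$ is the minimum $k$ such that its expansion contains a monomial $c\prod_v x_v^{t_v}$ with $c\neq0$ and $t_v<k$ for all $v$. -}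

module Defs where

open import Data.Nat as ℕ using (ℕ; zero; suc)
open import Data.Integer as ℤ using (ℤ; +_; -_; ∣_∣)
open import Data.Rational as ℚ using (ℚ; 0ℚ; 1ℚ)
open import Data.Sign using (Sign) renaming (+ to plus; - to minus)
open import Data.Fin using (Fin; toℕ)
open import Data.Fin.Properties using () renaming (_≟_ to _≟ᶠ_)
open import Data.Vec as Vec using (Vec)
open import Data.Vec.Properties using (≡-dec)
open import Data.List as List using (List; []; _∷_; length; lookup; concatMap; map; foldr)
open import Data.List.Relation.Unary.All using (All)
open import Data.List.Relation.Unary.Unique.Propositional using (Unique)
open import Data.List.Membership.Propositional using (_∈_)
open import Data.Product using (Σ; ∃; _×_; _,_; proj₁; proj₂)
open import Data.Sum using (_⊎_)
open import Relation.Binary.PropositionalEquality using (_≡_; _≢_)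
open import Relation.Nullary using (yes; no)
open import Relation.Nullary.Decidable using (⌊_⌋)
open import Data.Nat.Properties using () renaming (_≟_ to _≟ℕ_)

-- Signed graphs on vertex set Fin n.
-- Each edge is a triple (u , v , s) with toℕ u < toℕ v (so the graph is
-- loopless and the fixed linear order on vertices is the order of Fin n);
-- the pairs (u , v) are pairwise distinct (no parallel edges), and
-- s = σ(uv) ∈ {+1,-1} is represented by a Sign.

Edge : ℕ → Set
Edge n = Fin n × Fin n × Sign

ends : ∀ {n} → Edge n → Fin n × Fin n
ends (u , v , _) = u , v

record SignedGraph : Set where
  field
    n        : ℕ
    edges    : List (Edge n)
    ordered  : All (λ e → toℕ (proj₁ e) ℕ.< toℕ (proj₁ (proj₂ e))) edges
    simple   : Unique (map ends edges)
open SignedGraph public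

infix 25 _·_
_·_ : Sign → ℤ → ℤ
plus  · x = x
minus · x = - x

Proper : (G : SignedGraph) → (Fin (n G) → ℤ) → Set
Proper G φ = ∀ {u v s} → (u , v , s) ∈ edges G → φ u ≢ (s · φ v)

-- membership in M_k:  for even k, M_k = {±1,…,±k/2};
-- for odd k, M_k = {0,±1,…,±(k-1)/2}.
InM : ℕ → ℤ → Set
InM k x = ((x ≢ + 0) ⊎ (k ℕ.% 2 ≡ 1)) × (2 ℕ.* ∣ x ∣ ℕ.≤ k)

Colorable : ℕ → SignedGraph → Set
Colorable k G = Σ (Fin (n G) → ℤ) λ φ → Proper G φ × (∀ v → InM k (φ v))

IsListAssignment : (G : SignedGraph) → ℕ → (Fin (n G) → List ℤ) → Set
IsListAssignment G k L = ∀ v → length (L v) ≡ k × Unique (L v)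

Choosable : ℕ → SignedGraph → Set
Choosable k G = (L : Fin (n G) → List ℤ) → IsListAssignment G k L →
  Σ (Fin (n G) → ℤ) λ φ → Proper G φ × (∀ v → φ v ∈ L v)

-- Multivariate polynomials over ℤ in variables x_v (v : Fin n), represented
-- as (unnormalised) lists of terms  c · ∏ x_v^{t_v}.

Monomial : ℕ → Set
Monomial n = Vec ℕ n

Poly : ℕ → Set
Poly n = List (ℤ × Monomial n)

unitMono : ∀ {n} → Monomial n
unitMono = Vec.replicate _ 0

varMono : ∀ {n} → Fin n → Monomial n
varMono v = Vec.updateAt unitMono v (λ _ → 1)

onePoly : ∀ {n} → Poly n
onePoly = (+ 1 , unitMono) ∷ []

polyMul : ∀ {n} → Poly n → Poly n → Poly n
polyMul p q = concatMap (λ a → map (λ b → (proj₁ a ℤ.* proj₁ b , Vec.zipWith ℕ._+_ (proj₂ a) (proj₂ b))) q) p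

edgeFactor : ∀ {n} → Edge n → Poly n
edgeFactor (u , v , s) = (+ 1 , varMono u) ∷ (- (s · (+ 1)) , varMono v) ∷ []

graphPoly : (G : SignedGraph) → Poly (n G)
graphPoly G = foldr (λ e p → polyMul (edgeFactor e) p) onePoly (edges G)

coeff : ∀ {n} → Poly n → Monomial n → ℤ
coeff p t = foldr (λ a acc → (if ⌊ ≡-dec _≟ℕ_ (proj₂ a) t ⌋ then proj₁ a else + 0) ℤ.+ acc) (+ 0) p
  where
  open import Data.Bool using (if_then_else_)

-- AT(G,σ) ≤ k : the expansion of P_{G,σ} has a monomial with nonzero
-- coefficient all of whose exponents are < k.  (Since this condition is
-- monotone in k, it is equivalent to "the minimum such k is ≤ k".)
AT≤ : SignedGraph → ℕ → Set
AT≤ G k = Σ (Monomial (n G)) λ t → coeff (graphPoly G) t ≢ + 0 × Vec.All (λ e → e ℕ.< k) t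
  where
  open import Data.Vec.Relation.Unary.All as Vec using ()

-- Planarity: a piecewise-linear drawing with rational coordinates.
-- Vertices go to distinct points of ℚ²; each edge is drawn as a polygonal
-- arc (with rational break points) from its first to its second end; two
-- distinct edges' arcs meet only in positions of common end vertices, and
-- an arc contains the position of a vertex only if that vertex is one of
-- its ends.

Point : Set
Point = ℚ × ℚ

OnSeg : Point → Point → Point → Set
OnSeg (px , py) (ax , ay) (bx , by) =
  Σ ℚ λ t → (0ℚ ℚ.≤ t) × (t ℚ.≤ 1ℚ) ×
    (px ≡ ax ℚ.+ t ℚ.* (bx ℚ.- ax)) × (py ≡ ay ℚ.+ t ℚ.* (by ℚ.- ay))

OnPoly : Point → Point → List Point → Point → Set
OnPoly p a []       b = OnSeg p a b
OnPoly p a (c ∷ cs) b = OnSeg p a c ⊎ OnPoly p c cs b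

record PlaneDrawing (G : SignedGraph) : Set where
  field
    pos       : Fin (n G) → Point
    pos-inj   : ∀ u v → pos u ≡ pos v → u ≡ v
    bends     : Fin (length (edges G)) → List Point
  OnArc : Point → Fin (length (edges G)) → Set
  OnArc p i = OnPoly p (pos (proj₁ (lookup (edges G) i))) (bends i)
                       (pos (proj₁ (proj₂ (lookup (edges G) i))))
  IsEnd : Fin (n G) → Fin (length (edges G)) → Set
  IsEnd w i = (w ≡ proj₁ (lookup (edges G) i)) ⊎ (w ≡ proj₁ (proj₂ (lookup (edges G) i)))
  field
    no-cross  : ∀ i j p → i ≢ j → OnArc p i → OnArc p j →
                  Σ (Fin (n G)) λ w → IsEnd w i × IsEnd w j × p ≡ pos w
    no-pass   : ∀ i w → OnArc (pos w) i → IsEnd w i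

Planar : SignedGraph → Set
Planar G = PlaneDrawing G

-- (i) At a proper colouring by ±1 the two terms of every edge factor have the same value, so all terms of
-- the graph polynomial do, and no cancellation occurs: a monomial occurring in the product has a nonzero
-- coefficient. It remains to orient a planar graph with out-degrees at most 3. This is done by contracting
-- edges. A drawing in which only the arcs of disjoint edges are required to be disjoint stays one after a
-- contraction, and K₅ has none, by counting modulo 2 how often the upward rays from the vertices meet the
-- arcs. Hence the neighbourhood of a vertex v has no K₄ minor, so by Dirac it contains an x of degree at
-- most 2, that is, the edge vx lies in at most two triangles. Contract it, orient by induction, and split
-- the merged vertex again: at most three new edges arise, and they find room at v and x.
--
-- (ii) For disjoint lists of three colours at two poles, every pair (p , q) of pole colours is blocked by
-- two adjacent vertices joined to both poles with list {−p , −q , 0}, all edges being negative.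

module Submission where

open import Defs
open import Data.Product using (Σ; _×_; _,_)
open import Relation.Nullary using (¬_)

-- Orientations with out-degrees at most 3 also follow from the bound 3n - 6 on the edges of planar
-- graphs. That route needs Euler's formula and thus faces; here the drawing enters only through the
-- parity of ray counts, and everything after the exclusion of K₅ is combinatorial. Dirac's theorem
-- is proved in a form that exempts the ends of one edge, because a contraction may lower degrees at
-- the merged vertex and the exempted edge absorbs that loss.
--
-- In (ii) there are nine gadgets, one for each of the 3 · 3 pairs of pole colours. The colour 0 is
-- the only one equal to its own negative, so two adjacent zeros conflict along a negative edge
-- while equal non-zero colours do not. In the drawing, the tangents from the pole (10 , -1000) to
-- the parabola touch it at abscissas near -23 and 43, so all side vertices, with abscissas 0 to 17,
-- are visible from below; the pole (9 , 1000) lies above the lines through all the chords. The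
-- abscissas 9 and 10 differ so that no side vertex is collinear with both poles.

-- Rational points, determinants and the lexicographic order.

module Plane where

  open import Data.Rational as ℚ using (ℚ; 0ℚ; 1ℚ; _+_; _*_; _-_; -_; _<_; _≤_; 1/_)
  import Data.Rational.Properties as ℚP
  open import Data.Rational.Solver using (module +-*-Solver)
  open import Data.Product using (Σ; _×_; _,_; proj₁; proj₂)
  open import Data.Sum using (_⊎_; inj₁; inj₂)
  open import Data.Empty using (⊥-elim)
  open import Relation.Nullary using (¬_)
  open import Relation.Binary using (tri<; tri≈; tri>)
  open import Relation.Binary.PropositionalEquality

  infixl 6 _⊖_
  _⊖_ : Point → Point → Point
  (ax , ay) ⊖ (bx , by) = ax - bx , ay - by

  det : Point → Point → Point → ℚ
  det (ax , ay) (bx , by) (cx , cy) = (bx - ax) * (cy - ay) - (by - ay) * (cx - ax)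

  -- The positive cone of the lexicographic order. Comparing abscissas first and ordinates second
  -- amounts to turning the plane infinitesimally, so that distinct points never lie on a common
  -- vertical line.
  data Pos : Point → Set where
    right : ∀ {x y} → 0ℚ < x → Pos (x , y)
    above : ∀ {x y} → x ≡ 0ℚ → 0ℚ < y → Pos (x , y)

  infix 4 _≺_
  -- Wrapped in a record so that the two points can be inferred.
  record _≺_ (a b : Point) : Set where
    constructor ≺-intro
    field ≺-pos : Pos (b ⊖ a)
  open _≺_ public

  module Q where
    open +-*-Solver public
    :det : ∀ {n} (ax ay bx by cx cy : Polynomial n) → Polynomial n
    :det ax ay bx by cx cy = (bx :- ax) :* (cy :- ay) :- (by :- ay) :* (cx :- ax)
  open Q

  p-q≡0⇒p≡q : ∀ {p q} → p - q ≡ 0ℚ → p ≡ q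
  p-q≡0⇒p≡q {p} {q} e = trans (solve 2 (λ p q → p := (p :- q) :+ q) refl p q)
    (trans (cong (_+ q) e) (ℚP.+-identityˡ q))

  p<q⇒0<q-p : ∀ {p q} → p < q → 0ℚ < q - p
  p<q⇒0<q-p {p} {q} l = subst (_< q - p) (ℚP.+-inverseʳ p) (ℚP.+-monoˡ-< (- p) l)

  0<-neg : ∀ {p} → p < 0ℚ → 0ℚ < - p
  0<-neg l = ℚP.neg-antimono-< l

  0<+ : ∀ {p q} → 0ℚ < p → 0ℚ < q → 0ℚ < p + q
  0<+ a b = ℚP.+-mono-< a b

  0<* : ∀ {p q} → 0ℚ < p → 0ℚ < q → 0ℚ < p * q
  0<* {p} {q} a b = subst (_< p * q) (ℚP.*-zeroʳ p) (ℚP.*-monoʳ-<-pos p {{ℚ.positive a}} b)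

  *-cancelˡ-≡ : ∀ {d p q} → d ≢ 0ℚ → d * p ≡ d * q → p ≡ q
  *-cancelˡ-≡ {d} {p} {q} d≢0 e = trans (sym (k p)) (trans (cong (1/ d *_) e) (k q))
    where
    instance nz = ℚ.≢-nonZero d≢0
    k : ∀ x → 1/ d * (d * x) ≡ x
    k x = trans (sym (ℚP.*-assoc (1/ d) d x)) (trans (cong (_* x) (ℚP.*-inverseˡ d)) (ℚP.*-identityˡ x))

  divide : ∀ {n d} → 0ℚ < d → 0ℚ ≤ n → n ≤ d → Σ ℚ λ s → 0ℚ ≤ s × s ≤ 1ℚ × d * s ≡ n
  divide {n} {d} l n≥0 n≤d = n * 1/ d ,
      subst (_≤ n * 1/ d) (ℚP.*-zeroˡ (1/ d)) (ℚP.*-monoʳ-≤-nonNeg (1/ d) n≥0) ,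
      subst (n * 1/ d ≤_) (ℚP.*-inverseʳ d) (ℚP.*-monoʳ-≤-nonNeg (1/ d) n≤d) ,
      trans (solve 3 (λ d n e → d :* (n :* e) := (d :* e) :* n) refl d n (1/ d))
        (trans (cong (_* n) (ℚP.*-inverseʳ d)) (ℚP.*-identityˡ n))
    where
    instance
      pd = ℚ.positive l
      nz = ℚP.pos⇒nonZero d
      pi = ℚP.1/pos⇒pos d
      ni = ℚP.pos⇒nonNeg (1/ d)

  Pos-irrefl : ¬ Pos (0ℚ , 0ℚ)
  Pos-irrefl (right l)   = ℚP.<-irrefl refl l
  Pos-irrefl (above _ l) = ℚP.<-irrefl refl l

  Pos-+ : ∀ {ax ay bx by} → Pos (ax , ay) → Pos (bx , by) → Pos (ax + bx , ay + by)
  Pos-+ (right l) (right m) = right (0<+ l m)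
  Pos-+ (right l) (above refl m) = right (subst (0ℚ <_) (sym (ℚP.+-identityʳ _)) l)
  Pos-+ (above refl l) (right m) = right (subst (0ℚ <_) (sym (ℚP.+-identityˡ _)) m)
  Pos-+ (above refl l) (above refl m) = above refl (0<+ l m)

  Pos-* : ∀ {c ax ay} → 0ℚ < c → Pos (ax , ay) → Pos (c * ax , c * ay)
  Pos-* l (right m) = right (0<* l m)
  Pos-* {c} l (above refl m) = above (ℚP.*-zeroʳ c) (0<* l m)

  Pos-tri : ∀ v → Pos v ⊎ v ≡ (0ℚ , 0ℚ) ⊎ Pos (- proj₁ v , - proj₂ v)
  Pos-tri (x , y) with ℚP.<-cmp 0ℚ x
  ... | tri< l _ _ = inj₁ (right l)
  ... | tri> _ _ g = inj₂ (inj₂ (right (0<-neg g)))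
  ... | tri≈ _ refl _ with ℚP.<-cmp 0ℚ y
  ...   | tri< l _ _ = inj₁ (above refl l)
  ...   | tri≈ _ refl _ = inj₂ (inj₁ refl)
  ...   | tri> _ _ g = inj₂ (inj₂ (above refl (0<-neg g)))

  ≺-irrefl : ∀ {a} → ¬ a ≺ a
  ≺-irrefl {x , y} (≺-intro p) = Pos-irrefl (subst Pos (cong₂ _,_ (ℚP.+-inverseʳ x) (ℚP.+-inverseʳ y)) p)

  ≺-trans : ∀ {a b c} → a ≺ b → b ≺ c → a ≺ c
  ≺-trans {ax , ay} {bx , by} {cx , cy} (≺-intro p) (≺-intro q) =
    ≺-intro (subst Pos (cong₂ _,_ (e ax bx cx) (e ay by cy)) (Pos-+ p q))
    where
    e : ∀ a b c → (b - a) + (c - b) ≡ c - a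
    e = solve 3 (λ a b c → (b :- a) :+ (c :- b) := c :- a) refl

  ≺-asym : ∀ {a b} → a ≺ b → ¬ b ≺ a
  ≺-asym p q = ≺-irrefl (≺-trans p q)

  ≺-tri : ∀ a b → a ≺ b ⊎ a ≡ b ⊎ b ≺ a
  ≺-tri (ax , ay) (bx , by) with Pos-tri ((bx , by) ⊖ (ax , ay))
  ... | inj₁ p = inj₁ (≺-intro p)
  ... | inj₂ (inj₁ e) = inj₂ (inj₁ (sym (cong₂ _,_ (p-q≡0⇒p≡q (cong proj₁ e)) (p-q≡0⇒p≡q (cong proj₂ e)))))
  ... | inj₂ (inj₂ p) = inj₂ (inj₂ (≺-intro (subst Pos (cong₂ _,_ (flip ax bx) (flip ay by)) p)))
    where
    flip : ∀ a b → - (b - a) ≡ a - b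
    flip = solve 2 (λ a b → :- (b :- a) := a :- b) refl

  -- The cone is closed under sums and positive multiples and omits 0; `c ≤ 0` would write 0 as a
  -- sum of its elements.
  combination-positive : ∀ {a b c P Q R} → Pos P → Pos Q → Pos R → 0ℚ < a → 0ℚ < b →
    c * proj₁ Q ≡ a * proj₁ R + b * proj₁ P → c * proj₂ Q ≡ a * proj₂ R + b * proj₂ P → 0ℚ < c
  combination-positive {a} {b} {c} {P} {Q = qx , qy} P⁺ Q⁺ R⁺ a⁺ b⁺ ex ey with ℚP.<-cmp 0ℚ c
  ... | tri< l _ _ = l
  ... | tri≈ _ refl _ = ⊥-elim (Pos-irrefl (subst Pos (cong₂ _,_ (trans (sym ex) (ℚP.*-zeroˡ qx)) (trans (sym ey) (ℚP.*-zeroˡ qy)))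
          (Pos-+ (Pos-* a⁺ R⁺) (Pos-* b⁺ P⁺))))
  ... | tri> _ _ g = ⊥-elim (Pos-irrefl (subst Pos (cong₂ _,_ (z ex) (z ey))
          (Pos-+ (Pos-* (0<-neg g) Q⁺) (Pos-+ (Pos-* a⁺ R⁺) (Pos-* b⁺ P⁺)))))
    where
    z : ∀ {q r} → c * q ≡ r → - c * q + r ≡ 0ℚ
    z {q} refl = solve 2 (λ c q → :- c :* q :+ c :* q := con 0ℚ) refl c q

  at : ℚ → Point → Point → Point
  at t (ax , ay) (bx , by) = ax + t * (bx - ax) , ay + t * (by - ay)

  at-onSeg : ∀ {t a b} → 0ℚ ≤ t → t ≤ 1ℚ → OnSeg (at t a b) a b
  at-onSeg {t} l u = t , l , u , refl , refl

  at-0 : ∀ a b → at 0ℚ a b ≡ a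
  at-0 (ax , ay) (bx , by) = cong₂ _,_ (e ax bx) (e ay by)
    where
    e : ∀ a b → a + 0ℚ * (b - a) ≡ a
    e = solve 2 (λ a b → a :+ con 0ℚ :* (b :- a) := a) refl

  at-1 : ∀ a b → at 1ℚ a b ≡ b
  at-1 (ax , ay) (bx , by) = cong₂ _,_ (e ax bx) (e ay by)
    where
    e : ∀ a b → a + 1ℚ * (b - a) ≡ b
    e = solve 2 (λ a b → a :+ con 1ℚ :* (b :- a) := b) refl

  onSegˡ : ∀ a b → OnSeg a a b
  onSegˡ a b = subst (λ p → OnSeg p a b) (at-0 a b) (at-onSeg {0ℚ} {a} {b} ℚP.≤-refl (ℚP.<⇒≤ (ℚP.positive⁻¹ 1ℚ)))

  onSegʳ : ∀ a b → OnSeg b a b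
  onSegʳ a b = subst (λ p → OnSeg p a b) (at-1 a b) (at-onSeg {1ℚ} {a} {b} (ℚP.<⇒≤ (ℚP.positive⁻¹ 1ℚ)) ℚP.≤-refl)

  at-between : ∀ {t a b} → 0ℚ < t → t < 1ℚ → a ≺ b → a ≺ at t a b × at t a b ≺ b
  at-between {t} {ax , ay} {bx , by} l u (≺-intro p) =
    ≺-intro (subst Pos (cong₂ _,_ (e ax bx) (e ay by)) (Pos-* l p)) ,
    ≺-intro (subst Pos (cong₂ _,_ (f ax bx) (f ay by)) (Pos-* (p<q⇒0<q-p u) p))
    where
    e : ∀ a b → t * (b - a) ≡ a + t * (b - a) - a
    e a b = solve 3 (λ t a b → t :* (b :- a) := a :+ t :* (b :- a) :- a) refl t a b
    f : ∀ a b → (1ℚ - t) * (b - a) ≡ b - (a + t * (b - a))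
    f a b = solve 3 (λ t a b → (con 1ℚ :- t) :* (b :- a) := b :- (a :+ t :* (b :- a))) refl t a b

  Pos⇒0≤x : ∀ {x y} → Pos (x , y) → 0ℚ ≤ x
  Pos⇒0≤x (right l)      = ℚP.<⇒≤ l
  Pos⇒0≤x (above refl _) = ℚP.≤-refl

  Pos⇒0≤y : ∀ {x y} → x ≡ 0ℚ → Pos (x , y) → 0ℚ ≤ y
  Pos⇒0≤y refl (right l)   = ⊥-elim (ℚP.<-irrefl refl l)
  Pos⇒0≤y e    (above _ l) = ℚP.<⇒≤ l

  0≤-⇒-≤- : ∀ a b x → 0ℚ ≤ b - x → x - a ≤ b - a
  0≤-⇒-≤- a b x l = subst₂ _≤_ (ℚP.+-identityˡ (x - a))
    (solve 3 (λ x a b → (b :- x) :+ (x :- a) := b :- a) refl x a b) (ℚP.+-monoˡ-≤ (x - a) l)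

  -- The parameter of `x` is a quotient of differences of abscissas or, on a vertical segment, of
  -- ordinates. Lying between `a` and `b` keeps it in the unit interval and, in the vertical case,
  -- also fixes the abscissa of `x`.
  collinear⇒onSeg : ∀ {a b x} → a ≺ x → x ≺ b → det a b x ≡ 0ℚ → OnSeg x a b
  collinear⇒onSeg {ax , ay} {bx , by} {xx , xy} p q e = go (≺-pos p) (≺-pos q) (≺-pos (≺-trans p q))
    where
    det-eq : (bx - ax) * (xy - ay) ≡ (by - ay) * (xx - ax)
    det-eq = p-q≡0⇒p≡q {(bx - ax) * (xy - ay)} {(by - ay) * (xx - ax)} e
    back : ∀ a b x s → (b - a) * s ≡ x - a → x ≡ a + s * (b - a)
    back a b x s e = trans (solve 2 (λ x a → x := a :+ (x :- a)) refl x a)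
      (cong (a +_) (trans (sym e) (ℚP.*-comm (b - a) s)))
    go : Pos (xx - ax , xy - ay) → Pos (bx - xx , by - xy) → Pos (bx - ax , by - ay) → OnSeg (xx , xy) (ax , ay) (bx , by)
    go ax≺ x≺b (right l) = sloped (divide l (Pos⇒0≤x ax≺) (0≤-⇒-≤- ax bx xx (Pos⇒0≤x x≺b)))
      where
      sloped : (Σ ℚ λ s → 0ℚ ≤ s × s ≤ 1ℚ × (bx - ax) * s ≡ xx - ax) → OnSeg (xx , xy) (ax , ay) (bx , by)
      sloped (s , s≥0 , s≤1 , eq) = s , s≥0 , s≤1 , back ax bx xx s eq , back ay by xy s (*-cancelˡ-≡ {bx - ax} {(by - ay) * s} {xy - ay} (≢-sym (ℚP.<⇒≢ l))
        (trans (solve 3 (λ d e s → d :* (e :* s) := e :* (d :* s)) refl (bx - ax) (by - ay) s)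
          (trans (cong ((by - ay) *_) eq) (sym det-eq))))
    go ax≺ x≺b (above bx≡ax l) = vertical (divide l (Pos⇒0≤y xx≡ax ax≺) (0≤-⇒-≤- ay by xy (Pos⇒0≤y
          (trans (cong₂ _-_ (p-q≡0⇒p≡q {bx} {ax} bx≡ax) (p-q≡0⇒p≡q {xx} {ax} xx≡ax)) (ℚP.+-inverseʳ ax)) x≺b)))
      where
      xx≡ax : xx - ax ≡ 0ℚ
      xx≡ax = ℚP.≤-antisym (subst (xx - ax ≤_) bx≡ax (0≤-⇒-≤- ax bx xx (Pos⇒0≤x x≺b))) (Pos⇒0≤x ax≺)
      vertical : (Σ ℚ λ s → 0ℚ ≤ s × s ≤ 1ℚ × (by - ay) * s ≡ xy - ay) → OnSeg (xx , xy) (ax , ay) (bx , by)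
      vertical (s , s≥0 , s≤1 , eq) = s , s≥0 , s≤1 ,
          back ax bx xx s (trans (cong (_* s) bx≡ax) (trans (ℚP.*-zeroˡ s) (sym xx≡ax))) , back ay by xy s eq

  det-at : ∀ a b c d t → det a b (at t c d) ≡ det a b c + t * (det a b d - det a b c)
  det-at (ax , ay) (bx , by) (cx , cy) (dx , dy) t = solve 9 (λ ax ay bx by cx cy dx dy t →
    :det ax ay bx by (cx :+ t :* (dx :- cx)) (cy :+ t :* (dy :- cy)) :=
    :det ax ay bx by cx cy :+ t :* (:det ax ay bx by dx dy :- :det ax ay bx by cx cy)) refl ax ay bx by cx cy dx dy t

  OppositeSigns : ℚ → ℚ → Set
  OppositeSigns p q = (p < 0ℚ × 0ℚ < q) ⊎ (0ℚ < p × q < 0ℚ)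

  Crossing : ℚ → ℚ → Set
  Crossing p q = Σ ℚ λ t → 0ℚ < t × t < 1ℚ × p + t * (q - p) ≡ 0ℚ

  zero-between : ∀ {p q} → OppositeSigns p q → Crossing p q
  zero-between {p} {q} (inj₁ (p⁻ , q⁺)) = t , t>0 , t<1 , eq
    where
    d = q - p
    d>0 : 0ℚ < d
    d>0 = 0<+ q⁺ (0<-neg p⁻)
    instance
      pd = ℚ.positive d>0
      nz = ℚP.pos⇒nonZero d
      pi = ℚP.1/pos⇒pos d
    t = - p * 1/ d
    t>0 : 0ℚ < t
    t>0 = 0<* (0<-neg p⁻) (ℚP.positive⁻¹ (1/ d))
    t<1 : t < 1ℚ
    t<1 = subst (t <_) (ℚP.*-inverseʳ d) (ℚP.*-monoˡ-<-pos (1/ d)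
      (subst (_< d) (ℚP.+-identityˡ (- p)) (ℚP.+-monoˡ-< (- p) q⁺)))
    eq : p + t * d ≡ 0ℚ
    eq = trans (solve 3 (λ p d e → p :+ (:- p :* e) :* d := p :- p :* (e :* d)) refl p d (1/ d))
      (trans (cong (λ z → p - p * z) (ℚP.*-inverseˡ d)) (solve 1 (λ p → p :- p :* con 1ℚ := con 0ℚ) refl p))
  zero-between {p} {q} (inj₂ (p⁺ , q⁻)) = negate (zero-between (inj₁ (ℚP.neg-antimono-< p⁺ , 0<-neg q⁻)))
    where
    negate : Crossing (- p) (- q) → Crossing p q
    negate (t , t>0 , t<1 , eq) = t , t>0 , t<1 ,
      trans (solve 3 (λ p q t → p :+ t :* (q :- p) := :- (:- p :+ t :* (:- q :- :- p))) refl p q t) (cong -_ eq)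

-- Ray parity for two disjoint segments.

module Segments where

  open Plane
  open import Data.Rational using (ℚ; 0ℚ; 1ℚ; _+_; _*_; _-_; -_; _<_; _≤_)
  import Data.Rational.Properties as ℚP
  open import Data.Product using (_×_; _,_; proj₁; proj₂)
  open import Data.Sum using (_⊎_; inj₁; inj₂)
  open import Data.Empty using (⊥; ⊥-elim)
  open import Data.Bool using (Bool; true; false; _∧_; _xor_; not)
  import Data.Bool.Properties as BP
  import Data.Bool.Solver
  open import Relation.Nullary using (¬_; Dec; does; yes; no)
  open import Relation.Nullary.Decidable using (dec-true; dec-false)
  open import Relation.Binary using (tri<; tri≈; tri>)
  open import Relation.Binary.PropositionalEquality

  open Q
  module X = Data.Bool.Solver.xor-∧-Solver

  infix 4 _≺?_
  _≺?_ : ∀ a b → Dec (a ≺ b)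
  a ≺? b = decide (≺-tri a b)
    where
    decide : a ≺ b ⊎ a ≡ b ⊎ b ≺ a → Dec (a ≺ b)
    decide (inj₁ p) = yes p
    decide (inj₂ (inj₁ refl)) = no ≺-irrefl
    decide (inj₂ (inj₂ p)) = no (≺-asym p)

  left : Point → Point → Bool
  left a b = does (a ≺? b)

  left-true : ∀ {a b} → a ≺ b → left a b ≡ true
  left-true {a} {b} = dec-true (a ≺? b)

  left-false : ∀ {a b} → b ≺ a → left a b ≡ false
  left-false {a} {b} p = dec-false (a ≺? b) (≺-asym p)

  left-flip : ∀ {a b} → a ≢ b → left b a ≡ not (left a b)
  left-flip {a} {b} a≢b = go (≺-tri a b)
    where
    go : a ≺ b ⊎ a ≡ b ⊎ b ≺ a → left b a ≡ not (left a b)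
    go (inj₁ p) = trans (left-false p) (cong not (sym (left-true p)))
    go (inj₂ (inj₁ e)) = ⊥-elim (a≢b e)
    go (inj₂ (inj₂ p)) = trans (left-true p) (cong not (sym (left-false p)))

  negative : ℚ → Bool
  negative q = does (q ℚP.<? 0ℚ)

  negative-true : ∀ {q} → q < 0ℚ → negative q ≡ true
  negative-true {q} = dec-true (q ℚP.<? 0ℚ)

  negative-false : ∀ {q} → 0ℚ < q → negative q ≡ false
  negative-false {q} p = dec-false (q ℚP.<? 0ℚ) (ℚP.<-asym p)

  -- Whether the upward ray from p meets the segment ab; the ray is tilted infinitesimally
  -- so that it never passes through a or b.
  rayHits : Point → Point → Point → Bool
  rayHits p a b = (left a p ∧ left p b ∧ negative (det a b p)) xor (left b p ∧ left p a ∧ negative (det b a p))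

  rayHits-swap : ∀ p a b → rayHits p a b ≡ rayHits p b a
  rayHits-swap p a b = BP.xor-comm (left a p ∧ left p b ∧ negative (det a b p)) _

  rayHits-between : ∀ {p a b} → a ≺ p → p ≺ b → rayHits p a b ≡ negative (det a b p)
  rayHits-between {p} {a} {b} l r = trans
    (cong₂ (λ x y → x xor (y ∧ left p a ∧ negative (det b a p)))
      (cong₂ (λ x y → x ∧ y ∧ negative (det a b p)) (left-true l) (left-true r)) (left-false r))
    (BP.xor-identityʳ (negative (det a b p)))

  rayHits-left : ∀ {p a b} → p ≺ a → p ≺ b → rayHits p a b ≡ false
  rayHits-left {p} {a} {b} l r = cong₂ (λ x y → (x ∧ left p b ∧ negative (det a b p)) xor (y ∧ left p a ∧ negative (det b a p)))
    (left-false l) (left-false r)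

  rayHits-right : ∀ {p a b} → a ≺ p → b ≺ p → rayHits p a b ≡ false
  rayHits-right {p} {a} {b} l r = trans
    (cong₂ (λ x y → (left a p ∧ x ∧ negative (det a b p)) xor (left b p ∧ y ∧ negative (det b a p))) (left-false r) (left-false l))
    (cong₂ _xor_ (BP.∧-zeroʳ (left a p)) (BP.∧-zeroʳ (left b p)))

  onSeg-swap : ∀ p a b → OnSeg p a b → OnSeg p b a
  onSeg-swap (px , py) (ax , ay) (bx , by) (t , t≥0 , t≤1 , ex , ey) =
    1ℚ - t , subst (_≤ 1ℚ - t) (ℚP.+-inverseʳ t) (ℚP.+-monoˡ-≤ (- t) t≤1) ,
    subst (1ℚ - t ≤_) (ℚP.+-identityʳ 1ℚ) (ℚP.+-monoʳ-≤ 1ℚ (ℚP.neg-antimono-≤ t≥0)) ,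
    trans ex (e ax bx) , trans ey (e ay by)
    where
    e : ∀ a b → a + t * (b - a) ≡ b + (1ℚ - t) * (a - b)
    e a b = solve 3 (λ t a b → a :+ t :* (b :- a) := b :+ (con 1ℚ :- t) :* (a :- b)) refl t a b

  record DisjointSegments (a b c d : Point) : Set where
    constructor disjoint
    field misses : ∀ p → OnSeg p a b → OnSeg p c d → ⊥
  open DisjointSegments public

  DisjointSegments-swapˡ : ∀ {a b c d} → DisjointSegments a b c d → DisjointSegments b a c d
  DisjointSegments-swapˡ {a} {b} h = disjoint λ p x y → misses h p (onSeg-swap p b a x) y

  DisjointSegments-swapʳ : ∀ {a b c d} → DisjointSegments a b c d → DisjointSegments a b d c
  DisjointSegments-swapʳ {c = c} {d} h = disjoint λ p x y → misses h p x (onSeg-swap p d c y)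

  DisjointSegments-flip : ∀ {a b c d} → DisjointSegments a b c d → DisjointSegments c d a b
  DisjointSegments-flip h = disjoint λ p x y → misses h p y x

  -- The right side is odd exactly when the ends of the two segments alternate in the order. In that
  -- case exactly one of the two inner ends has the other segment above it; if one segment is nested
  -- in the range of the other, both inner rays hit or both miss; if the ranges are separated, no
  -- ray hits.
  record RayParity (a b c d : Point) : Set where
    constructor rayParity
    field equation : (rayHits c a b xor rayHits d a b) xor (rayHits a c d xor rayHits b c d)
                   ≡ (left a c xor left a d) xor (left b c xor left b d)
  open RayParity public

  infix 4 _≼_
  _≼_ : Point → Point → Set
  a ≼ b = a ≡ b ⊎ a ≺ b

  ≺-≼-trans : ∀ {a b c} → a ≺ b → b ≼ c → a ≺ c
  ≺-≼-trans p (inj₁ refl) = p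
  ≺-≼-trans p (inj₂ q)    = ≺-trans p q

  ≼-≺-trans : ∀ {a b c} → a ≼ b → b ≺ c → a ≺ c
  ≼-≺-trans (inj₁ refl) q = q
  ≼-≺-trans (inj₂ p)    q = ≺-trans p q

  xor₄-cong : ∀ {x₁ x₂ x₃ x₄ y₁ y₂ y₃ y₄} → x₁ ≡ y₁ → x₂ ≡ y₂ → x₃ ≡ y₃ → x₄ ≡ y₄ →
    (x₁ xor x₂) xor (x₃ xor x₄) ≡ (y₁ xor y₂) xor (y₃ xor y₄)
  xor₄-cong refl refl refl refl = refl

  parity-separated : ∀ {a b c d} → a ≼ b → b ≺ c → c ≼ d → RayParity a b c d
  parity-separated {a} {b} {c} {d} a≼b b≺c c≼d = rayParity (trans
    (xor₄-cong (rayHits-right a≺c b≺c) (rayHits-right a≺d b≺d) (rayHits-left a≺c a≺d) (rayHits-left b≺c b≺d))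
    (sym (xor₄-cong (left-true a≺c) (left-true a≺d) (left-true b≺c) (left-true b≺d))))
    where
    a≺c = ≼-≺-trans a≼b b≺c
    b≺d = ≺-≼-trans b≺c c≼d
    a≺d = ≼-≺-trans a≼b b≺d

  data Sign≢0 (q : ℚ) : Set where
    is-neg : q < 0ℚ → Sign≢0 q
    is-pos : 0ℚ < q → Sign≢0 q

  sign≢0 : ∀ {q} → q ≢ 0ℚ → Sign≢0 q
  sign≢0 {q} q≢0 = go (ℚP.<-cmp q 0ℚ)
    where
    go : _ → Sign≢0 q
    go (tri< l _ _) = is-neg l
    go (tri≈ _ e _) = ⊥-elim (q≢0 e)
    go (tri> _ _ g) = is-pos g

  -- `det a b` is affine along `cd`, so a change of sign gives a point of `cd` on the line `ab`. The
  -- order places it between `a` and `b`, hence on the segment.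
  opposite-across : ∀ {a b c d} → a ≺ c → c ≼ d → d ≺ b → DisjointSegments a b c d → ¬ OppositeSigns (det a b c) (det a b d)
  opposite-across a≺c (inj₁ refl) d≺b disj (inj₁ (l , r)) = ℚP.<-asym l r
  opposite-across a≺c (inj₁ refl) d≺b disj (inj₂ (l , r)) = ℚP.<-asym l r
  opposite-across {a} {b} {c} {d} a≺c (inj₂ c≺d) d≺b disj o = cross (zero-between o)
    where
    cross : _ → ⊥
    cross (t , t>0 , t<1 , e) = misses disj (at t c d)
      (collinear⇒onSeg (≺-trans a≺c (proj₁ btw)) (≺-trans (proj₂ btw) d≺b) (trans (det-at a b c d t) e))
      (at-onSeg {t} {c} {d} (ℚP.<⇒≤ t>0) (ℚP.<⇒≤ t<1))
      where btw = at-between t>0 t<1 c≺d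

  parity-nested : ∀ {a b c d} → a ≺ c → c ≼ d → d ≺ b → DisjointSegments a b c d → RayParity a b c d
  parity-nested {a} {b} {c} {d} a≺c c≼d d≺b disj = rayParity (trans
    (xor₄-cong (rayHits-between a≺c c≺b) (rayHits-between a≺d d≺b) (rayHits-left a≺c a≺d) (rayHits-right c≺b d≺b))
    (trans (same (sign≢0 λ e → misses disj c (collinear⇒onSeg a≺c c≺b e) (onSegˡ c d))
               (sign≢0 λ e → misses disj d (collinear⇒onSeg a≺d d≺b e) (onSegʳ c d)))
      (sym (xor₄-cong (left-true a≺c) (left-true a≺d) (left-false c≺b) (left-false d≺b)))))
    where
    a≺d = ≺-≼-trans a≺c c≼d
    c≺b = ≼-≺-trans c≼d d≺b
    same : Sign≢0 (det a b c) → Sign≢0 (det a b d) → (negative (det a b c) xor negative (det a b d)) xor false ≡ false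
    same (is-neg l) (is-neg r) = cong₂ (λ x y → (x xor y) xor false) (negative-true l) (negative-true r)
    same (is-pos l) (is-pos r) = cong₂ (λ x y → (x xor y) xor false) (negative-false l) (negative-false r)
    same (is-neg l) (is-pos r) = ⊥-elim (opposite-across a≺c c≼d d≺b disj (inj₁ (l , r)))
    same (is-pos l) (is-neg r) = ⊥-elim (opposite-across a≺c c≼d d≺b disj (inj₂ (l , r)))

  abstract
    -- Coordinates of the plane identity [u,v]w + [v,w]u + [w,u]v = 0, where [ , ] is the
    -- determinant of two vectors: here u = d - c, v = a - c, w = b - c, and in the second pair of
    -- lemmas u = b - a, v = d - b, w = b - c.
    det-combination₁ˣ : ∀ ax ay bx by cx cy dx dy → let p = det (ax , ay) (bx , by) (cx , cy); q = det (cx , cy) (dx , dy) (bx , by) in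
      det (cx , cy) (dx , dy) (ax , ay) * (bx - cx) ≡ - p * (dx - cx) + - q * (cx - ax)
    det-combination₁ˣ = solve 8 (λ ax ay bx by cx cy dx dy → :det cx cy dx dy ax ay :* (bx :- cx) :=
      :- :det ax ay bx by cx cy :* (dx :- cx) :+ :- :det cx cy dx dy bx by :* (cx :- ax)) refl

    det-combination₁ʸ : ∀ ax ay bx by cx cy dx dy → let p = det (ax , ay) (bx , by) (cx , cy); q = det (cx , cy) (dx , dy) (bx , by) in
      det (cx , cy) (dx , dy) (ax , ay) * (by - cy) ≡ - p * (dy - cy) + - q * (cy - ay)
    det-combination₁ʸ = solve 8 (λ ax ay bx by cx cy dx dy → :det cx cy dx dy ax ay :* (by :- cy) :=
      :- :det ax ay bx by cx cy :* (dy :- cy) :+ :- :det cx cy dx dy bx by :* (cy :- ay)) refl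

    det-combination₂ˣ : ∀ ax ay bx by cx cy dx dy → let p = det (ax , ay) (bx , by) (cx , cy); q = det (cx , cy) (dx , dy) (bx , by) in
      det (ax , ay) (bx , by) (dx , dy) * (bx - cx) ≡ - p * (dx - bx) + - q * (bx - ax)
    det-combination₂ˣ = solve 8 (λ ax ay bx by cx cy dx dy → :det ax ay bx by dx dy :* (bx :- cx) :=
      :- :det ax ay bx by cx cy :* (dx :- bx) :+ :- :det cx cy dx dy bx by :* (bx :- ax)) refl

    det-combination₂ʸ : ∀ ax ay bx by cx cy dx dy → let p = det (ax , ay) (bx , by) (cx , cy); q = det (cx , cy) (dx , dy) (bx , by) in
      det (ax , ay) (bx , by) (dx , dy) * (by - cy) ≡ - p * (dy - by) + - q * (by - ay)
    det-combination₂ʸ = solve 8 (λ ax ay bx by cx cy dx dy → :det ax ay bx by dx dy :* (by :- cy) :=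
      :- :det ax ay bx by cx cy :* (dy :- by) :+ :- :det cx cy dx dy bx by :* (by :- ay)) refl

    -- Cramer's rule for the common point of the lines `ab` and `cd`, freed of its denominator: the
    -- left side follows `cd`, the right side `ab`.
    det-crossˣ : ∀ ax ay bx by cx cy dx dy → let p = det (ax , ay) (bx , by) (cx , cy); q = det (ax , ay) (bx , by) (dx , dy) in
      (q - p) * cx - p * (dx - cx) ≡ (q - p) * ax + det (cx , cy) (dx , dy) (ax , ay) * (bx - ax)
    det-crossˣ = solve 8 (λ ax ay bx by cx cy dx dy → 
      (:det ax ay bx by dx dy :- :det ax ay bx by cx cy) :* cx :- :det ax ay bx by cx cy :* (dx :- cx) :=
      (:det ax ay bx by dx dy :- :det ax ay bx by cx cy) :* ax :+ :det cx cy dx dy ax ay :* (bx :- ax)) refl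

    det-crossʸ : ∀ ax ay bx by cx cy dx dy → let p = det (ax , ay) (bx , by) (cx , cy); q = det (ax , ay) (bx , by) (dx , dy) in
      (q - p) * cy - p * (dy - cy) ≡ (q - p) * ay + det (cx , cy) (dx , dy) (ax , ay) * (by - ay)
    det-crossʸ = solve 8 (λ ax ay bx by cx cy dx dy → 
      (:det ax ay bx by dx dy :- :det ax ay bx by cx cy) :* cy :- :det ax ay bx by cx cy :* (dy :- cy) :=
      (:det ax ay bx by dx dy :- :det ax ay bx by cx cy) :* ay :+ :det cx cy dx dy ax ay :* (by :- ay)) refl

    det-slope : ∀ ax ay bx by cx cy dx dy → det (ax , ay) (bx , by) (dx , dy) - det (ax , ay) (bx , by) (cx , cy)
      ≡ det (cx , cy) (dx , dy) (ax , ay) - det (cx , cy) (dx , dy) (bx , by)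
    det-slope = solve 8 (λ ax ay bx by cx cy dx dy → :det ax ay bx by dx dy :- :det ax ay bx by cx cy :=
      :det cx cy dx dy ax ay :- :det cx cy dx dy bx by) refl

  module Interleaved {a b c d} (a≺c : a ≺ c) (c≺b : c ≺ b) (b≺d : b ≺ d) where

    p q r s : ℚ
    p = det a b c
    q = det c d b
    r = det c d a
    s = det a b d

    private
      ax = proj₁ a
      ay = proj₂ a
      bx = proj₁ b
      by = proj₂ b
      cx = proj₁ c
      cy = proj₂ c
      dx = proj₁ d
      dy = proj₂ d

    -- With `c` below `ab` and `b` below `cd`, the linear relations express `r` and `s` times a
    -- lexicographically positive vector as positive combinations of such vectors. So `a` lies above
    -- the line `cd`, and `d` above the line `ab`.
    both-positive : p < 0ℚ → q < 0ℚ → 0ℚ < r × 0ℚ < s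
    both-positive p⁻ q⁻ =
      combination-positive (≺-pos a≺c) (≺-pos c≺b) (≺-pos (≺-trans c≺b b≺d)) (0<-neg p⁻) (0<-neg q⁻)
        (det-combination₁ˣ ax ay bx by cx cy dx dy) (det-combination₁ʸ ax ay bx by cx cy dx dy) ,
      combination-positive (≺-pos (≺-trans a≺c c≺b)) (≺-pos c≺b) (≺-pos b≺d) (0<-neg p⁻) (0<-neg q⁻)
        (det-combination₂ˣ ax ay bx by cx cy dx dy) (det-combination₂ʸ ax ay bx by cx cy dx dy)

    negate-combination : ∀ {r p q w u v} → r * w ≡ - p * u + - q * v → - r * w ≡ p * u + q * v
    negate-combination {r} {p} {q} {w} {u} {v} e = trans (sym (ℚP.neg-distribˡ-* r w))
      (trans (cong -_ e) (solve 4 (λ p q u v → :- (:- p :* u :+ :- q :* v) := p :* u :+ q :* v) refl p q u v))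

    neg⇒<0 : ∀ {x} → 0ℚ < - x → x < 0ℚ
    neg⇒<0 {x} l = subst (_< 0ℚ) (solve 1 (λ x → :- :- x := x) refl x) (ℚP.neg-antimono-< l)

    both-negative : 0ℚ < p → 0ℚ < q → r < 0ℚ × s < 0ℚ
    both-negative p⁺ q⁺ =
      neg⇒<0 (combination-positive (≺-pos a≺c) (≺-pos c≺b) (≺-pos (≺-trans c≺b b≺d)) p⁺ q⁺
        (negate-combination {r} {p} {q} (det-combination₁ˣ ax ay bx by cx cy dx dy))
        (negate-combination {r} {p} {q} (det-combination₁ʸ ax ay bx by cx cy dx dy))) ,
      neg⇒<0 (combination-positive (≺-pos (≺-trans a≺c c≺b)) (≺-pos c≺b) (≺-pos b≺d) p⁺ q⁺
        (negate-combination {s} {p} {q} (det-combination₂ˣ ax ay bx by cx cy dx dy))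
        (negate-combination {s} {p} {q} (det-combination₂ʸ ax ay bx by cx cy dx dy)))

    opposite⇒-≢0 : ∀ {x y} → OppositeSigns x y → y - x ≢ 0ℚ
    opposite⇒-≢0 {x} {y} (inj₁ (l , r)) e = ℚP.<⇒≢ (ℚP.<-trans l r) (sym (p-q≡0⇒p≡q {y} {x} e))
    opposite⇒-≢0 {x} {y} (inj₂ (l , r)) e = ℚP.<⇒≢ (ℚP.<-trans r l) (p-q≡0⇒p≡q {y} {x} e)

    -- The common value s − p = r − q clears the denominators of t and u.
    meet : ∀ {a₁ b₁ c₁ d₁ t u} → s - p ≢ 0ℚ → p + t * (s - p) ≡ 0ℚ → r + u * (q - r) ≡ 0ℚ →
      (s - p) * c₁ - p * (d₁ - c₁) ≡ (s - p) * a₁ + r * (b₁ - a₁) →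
      a₁ + u * (b₁ - a₁) ≡ c₁ + t * (d₁ - c₁)
    meet {a₁} {b₁} {c₁} {d₁} {t} {u} k≢0 tEq uEq e = *-cancelˡ-≡ {s - p} k≢0 (trans lhs (trans (sym e) (sym rhs)))
      where
      uk≡r : u * (s - p) ≡ r
      uk≡r = trans (cong (u *_) (det-slope ax ay bx by cx cy dx dy))
        (sym (p-q≡0⇒p≡q {r} {u * (r - q)} (trans (solve 3 (λ r q u → r :- u :* (r :- q) := r :+ u :* (q :- r)) refl r q u) uEq)))
      tk≡-p : t * (s - p) ≡ - p
      tk≡-p = trans (solve 2 (λ p m → m := :- p :+ (p :+ m)) refl p (t * (s - p)))
        (trans (cong (- p +_) tEq) (ℚP.+-identityʳ (- p)))
      lhs : (s - p) * (a₁ + u * (b₁ - a₁)) ≡ (s - p) * a₁ + r * (b₁ - a₁)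
      lhs = trans (solve 4 (λ k a w u → k :* (a :+ u :* w) := k :* a :+ (u :* k) :* w) refl (s - p) a₁ (b₁ - a₁) u)
        (cong (λ z → (s - p) * a₁ + z * (b₁ - a₁)) uk≡r)
      rhs : (s - p) * (c₁ + t * (d₁ - c₁)) ≡ (s - p) * c₁ - p * (d₁ - c₁)
      rhs = trans (solve 4 (λ k a w u → k :* (a :+ u :* w) := k :* a :+ (u :* k) :* w) refl (s - p) c₁ (d₁ - c₁) t)
        (trans (cong (λ z → (s - p) * c₁ + z * (d₁ - c₁)) tk≡-p)
          (solve 3 (λ m p w → m :+ (:- p) :* w := m :- p :* w) refl ((s - p) * c₁) p (d₁ - c₁)))

    meeting-point : OppositeSigns p s → OppositeSigns r q → ¬ DisjointSegments a b c d
    meeting-point o₁ o₂ disj = go (zero-between o₁) (zero-between o₂)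
      where
      go : Crossing p s → Crossing r q → ⊥
      go (t , t>0 , t<1 , tEq) (u , u>0 , u<1 , uEq) = misses disj (at t c d)
        (subst (λ x → OnSeg x a b) (cong₂ _,_
            (meet {ax} {bx} {cx} {dx} {t} {u} (opposite⇒-≢0 o₁) tEq uEq (det-crossˣ ax ay bx by cx cy dx dy))
            (meet {ay} {by} {cy} {dy} {t} {u} (opposite⇒-≢0 o₁) tEq uEq (det-crossʸ ax ay bx by cx cy dx dy)))
          (at-onSeg {u} {a} {b} (ℚP.<⇒≤ u>0) (ℚP.<⇒≤ u<1)))
        (at-onSeg {t} {c} {d} (ℚP.<⇒≤ t>0) (ℚP.<⇒≤ t<1))

    parity : DisjointSegments a b c d → RayParity a b c d
    parity disj = rayParity (trans
      (xor₄-cong (rayHits-between a≺c c≺b) (rayHits-right a≺d b≺d) (rayHits-left a≺c a≺d) (rayHits-between c≺b b≺d))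
      (trans (differ (sign≢0 λ e → misses disj c (collinear⇒onSeg a≺c c≺b e) (onSegˡ c d))
                     (sign≢0 λ e → misses disj b (onSegʳ a b) (collinear⇒onSeg c≺b b≺d e)))
        (sym (xor₄-cong (left-true a≺c) (left-true a≺d) (left-false c≺b) (left-true b≺d)))))
      where
      a≺d = ≺-trans a≺c (≺-trans c≺b b≺d)
      differ : Sign≢0 p → Sign≢0 q → (negative p xor false) xor (false xor negative q) ≡ true
      differ (is-neg l) (is-pos m) = cong₂ (λ x y → (x xor false) xor (false xor y)) (negative-true l) (negative-false m)
      differ (is-pos l) (is-neg m) = cong₂ (λ x y → (x xor false) xor (false xor y)) (negative-false l) (negative-true m)
      -- Equal signs of `p` and `q` put `c` and `d` on different sides of `ab`, and `a` and `b` on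
      -- different sides of `cd`, so the segments cross.
      differ (is-neg l) (is-neg m) = ⊥-elim (meeting-point (inj₁ (l , proj₂ (both-positive l m))) (inj₂ (proj₁ (both-positive l m) , m)) disj)
      differ (is-pos l) (is-pos m) = ⊥-elim (meeting-point (inj₂ (l , proj₂ (both-negative l m))) (inj₁ (proj₁ (both-negative l m) , m)) disj)

  RayParity-swapˡ : ∀ {a b c d} → RayParity b a c d → RayParity a b c d
  RayParity-swapˡ {a} {b} {c} {d} e = rayParity (trans
    (trans (xor₄-cong (rayHits-swap c a b) (rayHits-swap d a b) (refl {x = rayHits a c d}) (refl {x = rayHits b c d}))
      (cong ((rayHits c b a xor rayHits d b a) xor_) (BP.xor-comm (rayHits a c d) (rayHits b c d))))
    (trans (equation e) (BP.xor-comm (left b c xor left b d) (left a c xor left a d))))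

  RayParity-swapʳ : ∀ {a b c d} → RayParity a b d c → RayParity a b c d
  RayParity-swapʳ {a} {b} {c} {d} e = rayParity (trans
    (trans (xor₄-cong (refl {x = rayHits c a b}) (refl {x = rayHits d a b}) (rayHits-swap a c d) (rayHits-swap b c d))
      (cong (_xor (rayHits a d c xor rayHits b d c)) (BP.xor-comm (rayHits c a b) (rayHits d a b))))
    (trans (equation e) (cong₂ _xor_ (BP.xor-comm (left a d) (left a c)) (BP.xor-comm (left b d) (left b c)))))

  xor-exchange : ∀ x y z w → (not x xor not y) xor (not z xor not w) ≡ (x xor z) xor (y xor w)
  xor-exchange = X.solve 4 (λ x y z w → ((one X.:+ x) X.:+ (one X.:+ y)) X.:+ ((one X.:+ z) X.:+ (one X.:+ w))
      X.:= (x X.:+ z) X.:+ (y X.:+ w)) refl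
    where
    one : ∀ {k} → X.Polynomial k
    one = X.con true

  -- Exchanging the segments negates each of the four comparisons, and four negations cancel modulo
  -- 2. Disjointness keeps the compared ends distinct.
  RayParity-flip : ∀ {a b c d} → DisjointSegments a b c d → RayParity c d a b → RayParity a b c d
  RayParity-flip {a} {b} {c} {d} disj e = rayParity (trans
    (BP.xor-comm (rayHits c a b xor rayHits d a b) (rayHits a c d xor rayHits b c d))
    (trans (equation e) (trans (xor₄-cong
        (left-flip {a} {c} λ { refl → misses disj a (onSegˡ a b) (onSegˡ c d) })
        (left-flip {b} {c} λ { refl → misses disj b (onSegʳ a b) (onSegˡ c d) })
        (left-flip {a} {d} λ { refl → misses disj a (onSegˡ a b) (onSegʳ c d) })
        (left-flip {b} {d} λ { refl → misses disj b (onSegʳ a b) (onSegʳ c d) }))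
      (xor-exchange (left a c) (left b c) (left a d) (left b d)))))

  parity-leftmost : ∀ {a b c d} → a ≼ b → c ≼ d → a ≺ c → DisjointSegments a b c d → RayParity a b c d
  parity-leftmost {a} {b} {c} {d} a≼b c≼d a≺c disj = go (≺-tri b c) (≺-tri b d)
    where
    go : b ≺ c ⊎ b ≡ c ⊎ c ≺ b → b ≺ d ⊎ b ≡ d ⊎ d ≺ b → RayParity a b c d
    go (inj₁ b≺c) _ = parity-separated a≼b b≺c c≼d
    go (inj₂ (inj₁ refl)) _ = ⊥-elim (misses disj b (onSegʳ a b) (onSegˡ b d))
    go (inj₂ (inj₂ c≺b)) (inj₁ b≺d) = Interleaved.parity a≺c c≺b b≺d disj
    go (inj₂ (inj₂ c≺b)) (inj₂ (inj₁ refl)) = ⊥-elim (misses disj b (onSegʳ a b) (onSegʳ c b))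
    go (inj₂ (inj₂ c≺b)) (inj₂ (inj₂ d≺b)) = parity-nested a≺c c≼d d≺b disj

  parity-sorted : ∀ {a b c d} → a ≼ b → c ≼ d → DisjointSegments a b c d → RayParity a b c d
  parity-sorted {a} {b} {c} {d} a≼b c≼d disj = go (≺-tri a c)
    where
    go : a ≺ c ⊎ a ≡ c ⊎ c ≺ a → RayParity a b c d
    go (inj₁ a≺c) = parity-leftmost a≼b c≼d a≺c disj
    go (inj₂ (inj₁ refl)) = ⊥-elim (misses disj a (onSegˡ a b) (onSegˡ a d))
    go (inj₂ (inj₂ c≺a)) = RayParity-flip disj (parity-leftmost c≼d a≼b c≺a (DisjointSegments-flip disj))

  ≼-total : ∀ a b → a ≼ b ⊎ b ≼ a
  ≼-total a b = go (≺-tri a b)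
    where
    go : a ≺ b ⊎ a ≡ b ⊎ b ≺ a → a ≼ b ⊎ b ≼ a
    go (inj₁ p) = inj₁ (inj₂ p)
    go (inj₂ (inj₁ e)) = inj₁ (inj₁ e)
    go (inj₂ (inj₂ p)) = inj₂ (inj₂ p)

  segment-parity : ∀ a b c d → DisjointSegments a b c d → RayParity a b c d
  segment-parity a b c d disj = go (≼-total a b) (≼-total c d)
    where
    go : a ≼ b ⊎ b ≼ a → c ≼ d ⊎ d ≼ c → RayParity a b c d
    go (inj₁ p) (inj₁ q) = parity-sorted p q disj
    go (inj₁ p) (inj₂ q) = RayParity-swapʳ (parity-sorted p q (DisjointSegments-swapʳ disj))
    go (inj₂ p) (inj₁ q) = RayParity-swapˡ (parity-sorted p q (DisjointSegments-swapˡ disj))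
    go (inj₂ p) (inj₂ q) = RayParity-swapˡ (RayParity-swapʳ (parity-sorted p q (DisjointSegments-swapˡ (DisjointSegments-swapʳ disj))))

-- Ray parity for polygonal arcs, and its sums over four and five points.

module Arcs where

  open Plane
  open Segments
  open import Data.List using (List; []; _∷_)
  open import Data.Sum using (inj₁; inj₂)
  open import Data.Empty using (⊥)
  open import Data.Bool using (Bool; true; false; _xor_; not)
  open import Relation.Binary.PropositionalEquality

  record DisjointArcs (a : Point) (cs : List Point) (b : Point) (c : Point) (ds : List Point) (d : Point) : Set where
    constructor disjoint
    field misses : ∀ p → OnPoly p a cs b → OnPoly p c ds d → ⊥

  polyHits : Point → Point → List Point → Point → Bool
  polyHits p a []       b = rayHits p a b
  polyHits p a (c ∷ cs) b = rayHits p a c xor polyHits p c cs b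

  record ArcParity (a : Point) (cs : List Point) (b : Point) (c : Point) (ds : List Point) (d : Point) : Set where
    constructor arcParity
    field equation : (polyHits c a cs b xor polyHits d a cs b) xor (polyHits a c ds d xor polyHits b c ds d)
                   ≡ (left a c xor left a d) xor (left b c xor left b d)

  -- Adds the equations of two pieces of an arc joined at a break point: the ray and the comparisons
  -- of the break point occur in both equations and cancel.
  telescopeˡ : ∀ u₁ v₁ u₂ v₂ x y z {l m r} → (u₁ xor v₁) xor (x xor y) ≡ l xor m → (u₂ xor v₂) xor (y xor z) ≡ m xor r →
    ((u₁ xor u₂) xor (v₁ xor v₂)) xor (x xor z) ≡ l xor r
  telescopeˡ u₁ v₁ u₂ v₂ x y z {l} {m} {r} e₁ e₂ = trans
    (X.solve 7 (λ u₁ v₁ u₂ v₂ x y z → ((u₁ X.:+ u₂) X.:+ (v₁ X.:+ v₂)) X.:+ (x X.:+ z) X.:=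
      ((u₁ X.:+ v₁) X.:+ (x X.:+ y)) X.:+ ((u₂ X.:+ v₂) X.:+ (y X.:+ z))) refl u₁ v₁ u₂ v₂ x y z)
    (trans (cong₂ _xor_ e₁ e₂)
      (X.solve 3 (λ l m r → (l X.:+ m) X.:+ (m X.:+ r) X.:= l X.:+ r) refl l m r))

  telescopeʳ : ∀ u₁ v₁ u₂ v₂ x y z l l′ m m′ r r′ →
    (x xor y) xor (u₁ xor v₁) ≡ (l xor m) xor (l′ xor m′) → (y xor z) xor (u₂ xor v₂) ≡ (m xor r) xor (m′ xor r′) →
    (x xor z) xor ((u₁ xor u₂) xor (v₁ xor v₂)) ≡ (l xor r) xor (l′ xor r′)
  telescopeʳ u₁ v₁ u₂ v₂ x y z l l′ m m′ r r′ e₁ e₂ = trans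
    (X.solve 7 (λ u₁ v₁ u₂ v₂ x y z → (x X.:+ z) X.:+ ((u₁ X.:+ u₂) X.:+ (v₁ X.:+ v₂)) X.:=
      ((x X.:+ y) X.:+ (u₁ X.:+ v₁)) X.:+ ((y X.:+ z) X.:+ (u₂ X.:+ v₂))) refl u₁ v₁ u₂ v₂ x y z)
    (trans (cong₂ _xor_ e₁ e₂)
      (X.solve 6 (λ l l′ m m′ r r′ → ((l X.:+ m) X.:+ (l′ X.:+ m′)) X.:+ ((m X.:+ r) X.:+ (m′ X.:+ r′))
        X.:= (l X.:+ r) X.:+ (l′ X.:+ r′)) refl l l′ m m′ r r′))

  segment-arc-parity : ∀ a b c ds d → DisjointArcs a [] b c ds d → ArcParity a [] b c ds d
  segment-arc-parity a b c [] d h = arcParity (RayParity.equation (segment-parity a b c d (disjoint (DisjointArcs.misses h))))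
  segment-arc-parity a b c (e ∷ ds) d h = arcParity (telescopeʳ
    (rayHits a c e) (rayHits b c e) (polyHits a e ds d) (polyHits b e ds d) (rayHits c a b) (rayHits e a b) (rayHits d a b)
    (left a c) (left b c) (left a e) (left b e) (left a d) (left b d)
    (ArcParity.equation (segment-arc-parity a b c [] e (disjoint λ p x y → DisjointArcs.misses h p x (inj₁ y))))
    (ArcParity.equation (segment-arc-parity a b e ds d (disjoint λ p x y → DisjointArcs.misses h p x (inj₂ y)))))

  arc-parity : ∀ a cs b c ds d → DisjointArcs a cs b c ds d → ArcParity a cs b c ds d
  arc-parity a [] b c ds d h = segment-arc-parity a b c ds d h
  arc-parity a (e ∷ cs) b c ds d h = arcParity (telescopeˡ
    (rayHits c a e) (rayHits d a e) (polyHits c e cs b) (polyHits d e cs b)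
    (polyHits a c ds d) (polyHits e c ds d) (polyHits b c ds d) {left a c xor left a d} {left e c xor left e d} {left b c xor left b d}
    (ArcParity.equation (segment-arc-parity a e c ds d (disjoint λ p x y → DisjointArcs.misses h p (inj₁ x) y)))
    (ArcParity.equation (arc-parity e cs b c ds d (disjoint λ p x y → DisjointArcs.misses h p (inj₂ x) y))))

  onPoly-start : ∀ a cs b → OnPoly a a cs b
  onPoly-start a [] b = onSegˡ a b
  onPoly-start a (c ∷ cs) b = inj₁ (onSegˡ a c)

  onPoly-end : ∀ a cs b → OnPoly b a cs b
  onPoly-end a [] b = onSegʳ a b
  onPoly-end a (c ∷ cs) b = inj₂ (onPoly-end c cs b)

  -- `hijk` stands for the ray from `k` against the arc `ij`. It occurs once for each of the two
  -- remaining vertices as partner of `k`, hence twice.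
  quads-cancel : ∀ h012 h013 h014 h021 h023 h024 h031 h032 h034 h041 h042 h043 h120 h123 h124 h130 h132 h134 h140 h142 h143 h230 h231 h234 h240 h241 h243 h340 h341 h342 →
    (((h012 xor h013) xor (h230 xor h231)) xor (((h021 xor h023) xor (h130 xor h132)) xor ((h031 xor h032) xor (h120 xor h123)))) xor ((((h012 xor h014) xor (h240 xor h241)) xor (((h021 xor h024) xor (h140 xor h142)) xor ((h041 xor h042) xor (h120 xor h124)))) xor ((((h013 xor h014) xor (h340 xor h341)) xor (((h031 xor h034) xor (h140 xor h143)) xor ((h041 xor h043) xor (h130 xor h134)))) xor ((((h023 xor h024) xor (h340 xor h342)) xor (((h032 xor h034) xor (h240 xor h243)) xor ((h042 xor h043) xor (h230 xor h234)))) xor ((((h123 xor h124) xor (h341 xor h342)) xor (((h132 xor h134) xor (h241 xor h243)) xor ((h142 xor h143) xor (h231 xor h234)))))))) ≡ false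
  quads-cancel = X.solve 30 (λ h012 h013 h014 h021 h023 h024 h031 h032 h034 h041 h042 h043 h120 h123 h124 h130 h132 h134 h140 h142 h143 h230 h231 h234 h240 h241 h243 h340 h341 h342 →
    (((h012 X.:+ h013) X.:+ (h230 X.:+ h231)) X.:+ (((h021 X.:+ h023) X.:+ (h130 X.:+ h132)) X.:+ ((h031 X.:+ h032) X.:+ (h120 X.:+ h123)))) X.:+ ((((h012 X.:+ h014) X.:+ (h240 X.:+ h241)) X.:+ (((h021 X.:+ h024) X.:+ (h140 X.:+ h142)) X.:+ ((h041 X.:+ h042) X.:+ (h120 X.:+ h124)))) X.:+ ((((h013 X.:+ h014) X.:+ (h340 X.:+ h341)) X.:+ (((h031 X.:+ h034) X.:+ (h140 X.:+ h143)) X.:+ ((h041 X.:+ h043) X.:+ (h130 X.:+ h134)))) X.:+ ((((h023 X.:+ h024) X.:+ (h340 X.:+ h342)) X.:+ (((h032 X.:+ h034) X.:+ (h240 X.:+ h243)) X.:+ ((h042 X.:+ h043) X.:+ (h230 X.:+ h234)))) X.:+ ((((h123 X.:+ h124) X.:+ (h341 X.:+ h342)) X.:+ (((h132 X.:+ h134) X.:+ (h241 X.:+ h243)) X.:+ ((h142 X.:+ h143) X.:+ (h231 X.:+ h234)))))))) X.:= X.con false) refl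

  -- The three ways to split a, b, c, d into two pairs; xy says that x lies left of y, so not xy is yx.
  quad-sum : ∀ ac ad bc bd ab cd {x y z} → x ≡ (ac xor ad) xor (bc xor bd) → y ≡ (ab xor ad) xor (not bc xor cd) →
    z ≡ (ab xor ac) xor (not bd xor not cd) → x xor (y xor z) ≡ true
  quad-sum ac ad bc bd ab cd refl refl refl = X.solve 6 (λ ac ad bc bd ab cd →
    ((ac X.:+ ad) X.:+ (bc X.:+ bd)) X.:+ (((ab X.:+ ad) X.:+ ((one X.:+ bc) X.:+ cd)) X.:+
    ((ab X.:+ ac) X.:+ ((one X.:+ bd) X.:+ (one X.:+ cd)))) X.:= one) refl ac ad bc bd ab cd
    where
    one : ∀ {k} → X.Polynomial k
    one = X.con true

  module FivePoints {V : Set} (pos : V → Point) (arc : V → V → List Point) where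

    ArcsDisjoint : V → V → V → V → Set
    ArcsDisjoint u v w z = DisjointArcs (pos u) (arc u v) (pos v) (pos w) (arc w z) (pos z)

    hits : V → V → V → Bool
    hits u v w = polyHits (pos w) (pos u) (arc u v) (pos v)

    quad : V → V → V → V → Bool
    quad a b c d = ((hits a b c xor hits a b d) xor (hits c d a xor hits c d b)) xor
                  (((hits a c b xor hits a c d) xor (hits b d a xor hits b d c)) xor
                   ((hits a d b xor hits a d c) xor (hits b c a xor hits b c d)))

    apart : ∀ {a b c d x y} → ArcsDisjoint a b c d → OnPoly x (pos a) (arc a b) (pos b) → OnPoly y (pos c) (arc c d) (pos d) → x ≢ y
    apart {x = x} h on₁ on₂ refl = DisjointArcs.misses h x on₁ on₂

    -- Of the three splittings of four linearly ordered points into two pairs, exactly one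
    -- alternates.
    quad-odd : ∀ a b c d → ArcsDisjoint a b c d → ArcsDisjoint a c b d → ArcsDisjoint a d b c → quad a b c d ≡ true
    quad-odd a b c d h₁ h₂ h₃ = quad-sum (l a c) (l a d) (l b c) (l b d) (l a b) (l c d) (e a b c d h₁)
      (trans (e a c b d h₂) (cong (λ x → (l a b xor l a d) xor (x xor l c d)) (left-flip (≢-sym (apart h₂ (end a c) (start b d))))))
      (trans (e a d b c h₃) (cong₂ (λ x y → (l a b xor l a c) xor (x xor y))
        (left-flip (≢-sym (apart h₃ (end a d) (start b c)))) (left-flip (≢-sym (apart h₃ (end a d) (end b c))))))
      where
      l : V → V → Bool
      l x y = left (pos x) (pos y)
      start : ∀ x y → OnPoly (pos x) (pos x) (arc x y) (pos y)
      start x y = onPoly-start (pos x) (arc x y) (pos y)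
      end : ∀ x y → OnPoly (pos y) (pos x) (arc x y) (pos y)
      end x y = onPoly-end (pos x) (arc x y) (pos y)
      e : ∀ a b c d → ArcsDisjoint a b c d → (hits a b c xor hits a b d) xor (hits c d a xor hits c d b) ≡ (l a c xor l a d) xor (l b c xor l b d)
      e a b c d h = ArcParity.equation (arc-parity (pos a) (arc a b) (pos b) (pos c) (arc c d) (pos d) h)

-- Graphs with weak drawings, exclusion of K₅, and contraction.

module Minors where

  open Plane
  open Segments
  open Arcs
  open import Data.Nat as ℕ using (ℕ; suc)
  import Data.Nat.Properties as ℕP
  open import Data.Fin using (Fin; suc)
  open import Data.Fin.Patterns
  open import Data.Fin.Properties using (_≟_; any?)
  open import Data.List as List using (List; []; _∷_; _++_; length; filter)
  import Data.List.Properties as ListP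
  open import Data.List.Membership.Propositional using (_∈_; lose)
  open import Data.List.Membership.Propositional.Properties using (∈-filter⁺)
  open import Data.Sum as Sum using (_⊎_; inj₁; inj₂; [_,_]′)
  open import Data.Empty using (⊥)
  open import Data.Product using (Σ; ∃; ∃₂; _×_; _,_; proj₁; proj₂)
  open import Data.Bool using (true; false; _xor_; not; if_then_else_)
  open import Relation.Nullary using (¬_; Dec; does; yes; no; contradiction)
  open import Relation.Nullary.Decidable using (False; toWitnessFalse; _×-dec_; ¬?)
  open import Relation.Binary.PropositionalEquality

  record Graph (N : ℕ) : Set₁ where
    field
      E      : Fin N → Fin N → Set
      E?     : ∀ u v → Dec (E u v)
      E-sym  : ∀ {u v} → E u v → E v u
      E-irrefl : ∀ {u v} → E u v → u ≢ v
  open Graph public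

  infix 4 _⊆_
  _⊆_ : ∀ {N} → Graph N → Graph N → Set
  H ⊆ G = ∀ {u v} → E H u v → E G u v

  -- Arcs of edges with a common end may meet anywhere; this is what survives contraction.
  record Drawn {N} (G : Graph N) : Set where
    field
      pos  : Fin N → Point
      arc  : ∀ {u v} → E G u v → List Point
      disj : ∀ {u v w z} (e : E G u v) (f : E G w z) → u ≢ w → u ≢ z → v ≢ w → v ≢ z →
             DisjointArcs (pos u) (arc e) (pos v) (pos w) (arc f) (pos z)

  Drawn-⊆ : ∀ {N} {H G : Graph N} → H ⊆ G → Drawn G → Drawn H
  Drawn-⊆ H⊆G D = record { pos = pos ; arc = λ e → arc (H⊆G e) ; disj = λ e f → disj (H⊆G e) (H⊆G f) }
    where open Drawn D

  Clique : ∀ {N} → Graph N → ∀ {k} → (Fin k → Fin N) → Set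
  Clique G c = ∀ i j → i ≢ j → E G (c i) (c j)

  -- Each of the five quadruples contributes an odd sum, so the total is odd; yet every pair of a
  -- ray and an arc is counted twice in it.
  ¬K₅ : ∀ {N} {G : Graph N} → Drawn G → (c : Fin 5 → Fin N) → ¬ Clique G c
  ¬K₅ {G = G} D c K = contradiction (trans (sym odd) even) λ ()
    where
    open Drawn D
    arc′ : Fin 5 → Fin 5 → List Point
    arc′ i j with i ≟ j
    -- A dummy on the diagonal: a clique supplies arcs only between distinct vertices.
    ... | yes _  = []
    ... | no i≢j = arc (K i j i≢j)
    open FivePoints (λ i → pos (c i)) arc′
    dis : ∀ i j k l {_ : False (i ≟ j)} {_ : False (k ≟ l)} {_ : False (i ≟ k)} {_ : False (i ≟ l)} {_ : False (j ≟ k)} {_ : False (j ≟ l)} →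
      ArcsDisjoint i j k l
    dis i j k l {p} {q} {a} {b} {x} {y} with i ≟ j | k ≟ l
    ... | no i≢j | no k≢l = disj (K i j i≢j) (K k l k≢l) (ne i k a) (ne i l b) (ne j k x) (ne j l y)
      where
      ne : ∀ i j → False (i ≟ j) → c i ≢ c j
      ne i j f = E-irrefl G (K i j (toWitnessFalse f))
    odd : quad 0F 1F 2F 3F xor (quad 0F 1F 2F 4F xor (quad 0F 1F 3F 4F xor (quad 0F 2F 3F 4F xor quad 1F 2F 3F 4F))) ≡ true
    odd = cong₂ _xor_ (q 0F 1F 2F 3F) (cong₂ _xor_ (q 0F 1F 2F 4F) (cong₂ _xor_ (q 0F 1F 3F 4F) (cong₂ _xor_ (q 0F 2F 3F 4F) (q 1F 2F 3F 4F))))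
      where
      q : ∀ i j k l {a : False (i ≟ j)} {b : False (i ≟ k)} {x : False (i ≟ l)} {y : False (j ≟ k)} {z : False (j ≟ l)} {w : False (k ≟ l)}
            {y′ : False (k ≟ j)} {z′ : False (l ≟ j)} {w′ : False (l ≟ k)} →
        quad i j k l ≡ true
      q i j k l {a} {b} {x} {y} {z} {w} {y′} {z′} {w′} = quad-odd i j k l
        (dis i j k l {a} {w} {b} {x} {y} {z}) (dis i k j l {b} {z} {a} {x} {y′} {w}) (dis i l j k {x} {y} {a} {b} {z′} {w′})
    even : quad 0F 1F 2F 3F xor (quad 0F 1F 2F 4F xor (quad 0F 1F 3F 4F xor (quad 0F 2F 3F 4F xor quad 1F 2F 3F 4F))) ≡ false
    even = quads-cancel
      (hits 0F 1F 2F) (hits 0F 1F 3F) (hits 0F 1F 4F) (hits 0F 2F 1F) (hits 0F 2F 3F) (hits 0F 2F 4F)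
      (hits 0F 3F 1F) (hits 0F 3F 2F) (hits 0F 3F 4F) (hits 0F 4F 1F) (hits 0F 4F 2F) (hits 0F 4F 3F)
      (hits 1F 2F 0F) (hits 1F 2F 3F) (hits 1F 2F 4F) (hits 1F 3F 0F) (hits 1F 3F 2F) (hits 1F 3F 4F)
      (hits 1F 4F 0F) (hits 1F 4F 2F) (hits 1F 4F 3F) (hits 2F 3F 0F) (hits 2F 3F 1F) (hits 2F 3F 4F)
      (hits 2F 4F 0F) (hits 2F 4F 1F) (hits 2F 4F 3F) (hits 3F 4F 0F) (hits 3F 4F 1F) (hits 3F 4F 2F)

  merge : ∀ {N} → Fin N → Fin N → Fin N → Fin N
  merge x r v = if does (v ≟ x) then r else v

  merge-at : ∀ {N} (x r : Fin N) → merge x r x ≡ r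
  merge-at x r with x ≟ x
  ... | yes _  = refl
  ... | no x≢x = contradiction refl x≢x

  merge-off : ∀ {N} {x r v : Fin N} → v ≢ x → merge x r v ≡ v
  merge-off {x = x} {v = v} v≢x with v ≟ x
  ... | yes e = contradiction e v≢x
  ... | no _  = refl

  merge≢ : ∀ {N} {x r : Fin N} → r ≢ x → ∀ v → merge x r v ≢ x
  merge≢ {x = x} r≢x v e with v ≟ x
  ... | yes _  = r≢x e
  ... | no v≢x = v≢x e

  -- x stays as an isolated vertex, so that the vertex set does not change.
  contract : ∀ {N} → Graph N → Fin N → Fin N → Graph N
  contract G x r = record
    { E = λ u v → u ≢ v × ∃₂ λ u₀ v₀ → E G u₀ v₀ × merge x r u₀ ≡ u × merge x r v₀ ≡ v
    ; E? = λ u v → ¬? (u ≟ v) ×-dec any? λ u₀ → any? λ v₀ → E? G u₀ v₀ ×-dec merge x r u₀ ≟ u ×-dec merge x r v₀ ≟ v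
    ; E-sym = λ (u≢v , u₀ , v₀ , e , p , q) → ≢-sym u≢v , v₀ , u₀ , E-sym G e , q , p
    ; E-irrefl = proj₁
    }

  onPoly-++ : ∀ {p} a cs b ds c → OnPoly p a (cs ++ b ∷ ds) c → OnPoly p a cs b ⊎ OnPoly p b ds c
  onPoly-++ a [] b ds c o = o
  onPoly-++ a (e ∷ cs) b ds c (inj₁ o) = inj₁ (inj₁ o)
  onPoly-++ a (e ∷ cs) b ds c (inj₂ o) = Sum.map₁ inj₂ (onPoly-++ e cs b ds c o)

  module Routes {N} {G : Graph N} (D : Drawn G) (S : Fin N → Set) where
    open Drawn D

    OnArcOver : Point → Set
    OnArcOver p = ∃₂ λ a b → Σ (E G a b) λ e → S a × S b × OnPoly p (pos a) (arc e) (pos b)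

    -- A contracted edge runs along several old arcs. All that matters later is that each of its
    -- points lies on an old arc with both ends in `S`.
    Route : Fin N → Fin N → Set
    Route a b = Σ (List Point) λ bs → ∀ p → OnPoly p (pos a) bs (pos b) → OnArcOver p

    along : ∀ {a b} → E G a b → S a → S b → Route a b
    along e sa sb = arc e , λ p o → _ , _ , e , sa , sb , o

    infixr 5 _then_
    _then_ : ∀ {a b c} → Route a b → Route b c → Route a c
    _then_ {a} {b} {c} (bs , f) (cs , g) = bs ++ pos b ∷ cs , λ p o → [ f p , g p ]′ (onPoly-++ (pos a) bs (pos b) cs (pos c) o)

  -- An edge that ended at `x` is prolonged along the arc of `xr` to end at `r`. Edges of the
  -- contraction without a common end come from disjoint sets of old vertices, so their routes use
  -- only arcs of disjoint old edges; routes that share the arc of `xr` belong to edges meeting in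
  -- `r`.
  Drawn-contract : ∀ {N} {G : Graph N} {x r} → E G x r → Drawn G → Drawn (contract G x r)
  Drawn-contract {N} {G} {x} {r} xr D = record { pos = pos ; arc = λ e → proj₁ (route e) ; disj = disj′ }
    where
    open Drawn D
    m = merge x r

    Over : Fin N → Fin N → Fin N → Set
    Over u v w = m w ≡ u ⊎ m w ≡ v

    m-r : m r ≡ r
    m-r = merge-off (≢-sym (E-irrefl G xr))

    module R u v = Routes D (Over u v)

    to : ∀ {u v} u₀ {v₀} → m u₀ ≡ u ⊎ m u₀ ≡ v → R.Route u v u₀ v₀ → R.Route u v (m u₀) v₀
    to u₀ s ρ with u₀ ≟ x
    ... | yes refl = R._then_ _ _ (R.along _ _ (E-sym G xr) (subst (λ z → z ≡ _ ⊎ z ≡ _) (sym m-r) s) (subst (λ z → z ≡ _ ⊎ z ≡ _) (sym (merge-at x r)) s)) ρ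
    ... | no  _    = ρ

    from : ∀ {u v} {u₀} v₀ → m v₀ ≡ u ⊎ m v₀ ≡ v → R.Route u v u₀ v₀ → R.Route u v u₀ (m v₀)
    from v₀ s ρ with v₀ ≟ x
    ... | yes refl = R._then_ _ _ ρ (R.along _ _ xr (subst (λ z → z ≡ _ ⊎ z ≡ _) (sym (merge-at x r)) s) (subst (λ z → z ≡ _ ⊎ z ≡ _) (sym m-r) s))
    ... | no  _    = ρ

    route : ∀ {u v} → E (contract G x r) u v → R.Route u v u v
    route (_ , u₀ , v₀ , e , refl , refl) =
      to u₀ (inj₁ refl) (from v₀ (inj₂ refl) (R.along _ _ e (inj₁ refl) (inj₂ refl)))

    distinct : ∀ {u v w z a b} → u ≢ w → u ≢ z → v ≢ w → v ≢ z → Over u v a → Over w z b → a ≢ b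
    distinct p q s t (inj₁ refl) (inj₁ e) refl = p e
    distinct p q s t (inj₁ refl) (inj₂ e) refl = q e
    distinct p q s t (inj₂ refl) (inj₁ e) refl = s e
    distinct p q s t (inj₂ refl) (inj₂ e) refl = t e

    disj′ : ∀ {u v w z} (e : E (contract G x r) u v) (f : E (contract G x r) w z) → u ≢ w → u ≢ z → v ≢ w → v ≢ z →
      DisjointArcs (pos u) (proj₁ (route e)) (pos v) (pos w) (proj₁ (route f)) (pos z)
    disj′ {u} {v} {w} {z} e f p q s t = disjoint λ o on₁ on₂ → go o (proj₂ (route e) o on₁) (proj₂ (route f) o on₂)
      where
      d : ∀ {a b} → Over u v a → Over w z b → a ≢ b
      d = distinct p q s t
      go : ∀ o → R.OnArcOver u v o → R.OnArcOver w z o → ⊥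
      go o (a , b , e′ , sa , sb , on₁) (a′ , b′ , f′ , sa′ , sb′ , on₂) =
        DisjointArcs.misses (disj e′ f′ (d sa sa′) (d sa sb′) (d sb sa′) (d sb sb′)) o on₁ on₂

  -- The inductions run on the length of such a list: the type of vertices is never reduced, but a
  -- contracted vertex becomes isolated and can leave the list.
  Supported : ∀ {N} → Graph N → List (Fin N) → Set
  Supported G vs = ∀ {u v} → E G u v → u ∈ vs

  remove : ∀ {N} → Fin N → List (Fin N) → List (Fin N)
  remove x = filter (λ v → ¬? (v ≟ x))

  remove-shorter : ∀ {N} {x : Fin N} {vs k} → x ∈ vs → length vs ℕ.≤ suc k → length (remove x vs) ℕ.≤ k
  remove-shorter {x = x} {vs} x∈vs l = ℕP.≤-pred (ℕP.≤-trans
    (ListP.filter-notAll (λ v → ¬? (v ≟ x)) vs (lose x∈vs λ x≢x → x≢x refl)) l)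

  ∈-remove : ∀ {N} {x v : Fin N} {vs} → v ∈ vs → v ≢ x → v ∈ remove x vs
  ∈-remove {x = x} = ∈-filter⁺ (λ v → ¬? (v ≟ x))

  contract-supported : ∀ {N} {G : Graph N} {vs x r} → E G x r → Supported G vs → Supported (contract G x r) (remove x vs)
  contract-supported {x = x} {r} xr sup (_ , u₀ , v₀ , e , refl , refl) with u₀ ≟ x
  contract-supported {G = G} xr sup (_ , u₀ , v₀ , e , refl , refl) | yes _ = ∈-remove (sup (E-sym G xr)) (≢-sym (E-irrefl G xr))
  contract-supported xr sup (_ , u₀ , v₀ , e , refl , refl) | no u₀≢x = ∈-remove (sup e) u₀≢x

  -- Degree at least 3 without counting: no two vertices, equal or not, exhaust the neighbourhood.
  Deg≥3 : ∀ {N} → Graph N → Fin N → Set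
  Deg≥3 G u = ∀ p q → ∃ λ z → E G u z × z ≢ p × z ≢ q

-- Dirac's theorem on graphs without K₄ minor.

module Degrees where

  open Minors
  open import Data.Nat as ℕ using (ℕ; zero; suc)
  open import Data.Fin using (Fin; zero; suc)
  open import Data.Fin.Properties using (_≟_; any?)
  open import Data.List as List using ([]; length)
  open import Data.Sum using (_⊎_; inj₁; inj₂; [_,_]′)
  open import Data.Empty using (⊥; ⊥-elim)
  open import Data.Product using (∃; _×_; _,_; proj₁; proj₂)
  open import Relation.Nullary using (¬_; Dec; yes; no; contradiction)
  open import Relation.Nullary.Decidable using (_×-dec_; ¬?)
  open import Relation.Binary.PropositionalEquality

  delete : ∀ {N} → Graph N → Fin N → Graph N
  delete G x = record
    { E = λ u v → E G u v × u ≢ x × v ≢ x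
    ; E? = λ u v → E? G u v ×-dec ¬? (u ≟ x) ×-dec ¬? (v ≟ x)
    ; E-sym = λ (e , p , q) → E-sym G e , q , p
    ; E-irrefl = λ (e , _) → E-irrefl G e
    }

  K₄-at : ∀ {N} → Graph N → (a b c d : Fin N) → Set
  K₄-at G a b c d = E G a b × E G a c × E G a d × E G b c × E G b d × E G c d

  -- Dirac: a graph without K₄ minor has a vertex of degree at most 2, which can even be chosen off a given edge.
  module MinorClosed {N} (𝒞 : Graph N → Set)
    (𝒞-⊆ : ∀ {H G} → H ⊆ G → 𝒞 G → 𝒞 H)
    (𝒞-contract : ∀ {G x r} → E G x r → 𝒞 G → 𝒞 (contract G x r))
    (¬K₄ : ∀ {G} → 𝒞 G → ∀ {a b c d} → ¬ K₄-at G a b c d) where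

    -- A counterexample to the strengthened theorem: off the edge `rs` there are non-isolated
    -- vertices, and all of them have degree at least 3. The premise `E G y a` exempts the isolated
    -- vertices that contractions leave behind.
    record Dense (G : Graph N) (r s : Fin N) : Set where
      field
        edge  : E G r s
        deg   : ∀ {y a} → y ≢ r → y ≢ s → E G y a → Deg≥3 G y
        {y₀ a₀} : Fin N
        y₀≢r  : y₀ ≢ r
        y₀≢s  : y₀ ≢ s
        y₀a₀  : E G y₀ a₀

    NoDense : ℕ → Set₁
    NoDense k = ∀ {G vs} → 𝒞 G → Supported G vs → length vs ℕ.≤ k → ∀ {r s} → ¬ Dense G r s

    module _ {k} (ih : NoDense k) {G : Graph N} {vs} (G∈𝒞 : 𝒞 G) (sup : Supported G vs) (len : length vs ℕ.≤ suc k)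
             {r s} (D : Dense G r s) where
      open Dense D

      r≢s : r ≢ s
      r≢s = E-irrefl G edge

      -- Contracting y into z only adds edges at z, since r and s are not both adjacent to z.
      ¬deg3-neighbour : ∀ {y z} → E G y r → E G y s → E G y z → z ≢ r → z ≢ s →
        (∀ {w} → E G y w → w ≡ r ⊎ w ≡ s ⊎ w ≡ z) → ⊥
      ¬deg3-neighbour {y} {z} yr ys yz z≢r z≢s nbrs = ih (𝒞-contract yz G∈𝒞) (contract-supported {G = G} yz sup) (remove-shorter (sup yz) len) record
        { edge = r≢s , r , s , edge , merge-off r≢y , merge-off s≢y
        ; deg = deg′ ; y₀≢r = z≢r ; y₀≢s = z≢s ; y₀a₀ = zr′ }
        where
        r≢y = ≢-sym (E-irrefl G yr)
        s≢y = ≢-sym (E-irrefl G ys)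
        z≢y = ≢-sym (E-irrefl G yz)
        zr′ : E (contract G y z) z r
        zr′ = z≢r , y , r , yr , merge-at y z , merge-off r≢y
        zs′ : E (contract G y z) z s
        zs′ = z≢s , y , s , ys , merge-at y z , merge-off s≢y
        keep : ∀ {a b} → E G a b → a ≢ y → b ≢ y → E (contract G y z) a b
        keep e a≢y b≢y = E-irrefl G e , _ , _ , e , merge-off a≢y , merge-off b≢y
        -- Adjacency to both `r` and `s` would make `r`, `s`, `y`, `z` a K₄. If one of them is
        -- missing, a neighbour that avoids the other one and `y` avoids all three.
        z-third : ∃ λ t → E G z t × t ≢ r × t ≢ s × t ≢ y
        z-third with E? G z r | E? G z s
        ... | yes zr | yes zs = ⊥-elim (¬K₄ G∈𝒞 (edge , E-sym G yr , E-sym G zr , E-sym G ys , E-sym G zs , yz))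
        ... | no ¬zr | _ = let t , zt , t≢s , t≢y = deg z≢r z≢s (E-sym G yz) s y in t , zt , (λ eq → ¬zr (subst (E G z) eq zt)) , t≢s , t≢y
        ... | yes _ | no ¬zs = let t , zt , t≢r , t≢y = deg z≢r z≢s (E-sym G yz) r y in t , zt , t≢r , (λ eq → ¬zs (subst (E G z) eq zt)) , t≢y
        deg-z : Deg≥3 (contract G y z) z
        deg-z p q with r ≟ p | r ≟ q | s ≟ p | s ≟ q
        ... | no r≢p | no r≢q | _ | _ = r , zr′ , r≢p , r≢q
        ... | _ | _ | no s≢p | no s≢q = s , zs′ , s≢p , s≢q
        ... | yes refl | _ | yes refl | _ = contradiction refl r≢s
        ... | _ | yes refl | _ | yes refl = contradiction refl r≢s
        ... | yes refl | _ | _ | yes refl = let t , zt , t≢r , t≢s , t≢y = z-third in t , keep zt z≢y t≢y , t≢r , t≢s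
        ... | _ | yes refl | yes refl | _ = let t , zt , t≢r , t≢s , t≢y = z-third in t , keep zt z≢y t≢y , t≢s , t≢r
        deg′ : ∀ {w a} → w ≢ r → w ≢ s → E (contract G y z) w a → Deg≥3 (contract G y z) w
        deg′ {w} w≢r w≢s (w≢a , w₀ , a₀ , e , refl , refl) p q with w₀ ≟ y
        ... | yes _ = deg-z p q
        ... | no w≢y with w₀ ≟ z
        ...   | yes refl = deg-z p q
        ...   | no w≢z = let t , wt , t≢p , t≢q = deg w≢r w≢s e p q in
          t , keep wt w≢y (λ eq → [ w≢r , [ w≢s , w≢z ]′ ]′ (nbrs (E-sym G (subst (E G w₀) eq wt)))) , t≢p , t≢q

      -- Contracting `s` into `r` costs `y` a neighbour only if `y` is adjacent to both, and then
      -- just one. So `y` has exactly the neighbours `r`, `s` and a third one, the case excluded by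
      -- `¬deg3-neighbour`.
      ¬common-deg3 : ∀ {y p q} → y ≢ r → y ≢ s → ∀ {a} → E G y a →
        ¬ (∀ {w} → E (contract G s r) y w → w ≡ p ⊎ w ≡ q)
      ¬common-deg3 {y} {p} {q} y≢r y≢s ya few = go (E? G y r) (E? G y s)
        where
        m = merge s r
        image : ∀ {w} → E G y w → m w ≡ p ⊎ m w ≡ q
        image {w} e = few ((λ y≡ → y≢m w (E-irrefl G e) y≡) , y , w , e , merge-off y≢s , refl)
          where
          y≢m : ∀ w → y ≢ w → y ≢ m w
          y≢m w y≢w with w ≟ s
          ... | yes _ = y≢r
          ... | no _  = y≢w
        -- The preimage under m, among the vertices other than r.
        g : Fin N → Fin N
        g t with t ≟ r
        ... | yes _ = s
        ... | no _  = t
        g-m : ∀ {t} w → w ≢ r → m w ≡ t → w ≡ g t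
        g-m {t} w w≢r e with w ≟ s | t ≟ r
        ... | yes w≡s | yes _   = w≡s
        ... | yes _   | no t≢r  = contradiction (sym e) t≢r
        ... | no _    | yes t≡r = contradiction (trans e t≡r) w≢r
        ... | no _    | no _    = e
        go : Dec (E G y r) → Dec (E G y s) → ⊥
        go (no ¬yr) _ with deg y≢r y≢s ya (g p) (g q)
        ... | z , yz , z≢p , z≢q = [ (λ e → z≢p (g-m z z≢r e)) , (λ e → z≢q (g-m z z≢r e)) ]′ (image yz)
          where
          z≢r : z ≢ r
          z≢r refl = ¬yr yz
        go (yes _) (no ¬ys) with deg y≢r y≢s ya p q
        ... | z , yz , z≢p , z≢q = [ (λ e → z≢p (trans (sym mz) e)) , (λ e → z≢q (trans (sym mz) e)) ]′ (image yz)
          where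
          mz : m z ≡ z
          mz = merge-off λ { refl → ¬ys yz }
        go (yes yr) (yes ys) with deg y≢r y≢s ya r s
        ... | z , yz , z≢r , z≢s = ¬deg3-neighbour yr ys yz z≢r z≢s only
          where
          -- A further neighbour `w` would give `r`, `z` and `w` three distinct images, while only
          -- `p` and `q` are available.
          same : ∀ {w} → w ≢ r → w ≢ s → E G y w → w ≡ z
          same {w} w≢r w≢s yw with image yr | image yz | image yw
          ... | inj₁ a | inj₂ b | inj₂ c = trans (trans (sym (merge-off w≢s)) c) (trans (sym b) (merge-off z≢s))
          ... | inj₂ a | inj₁ b | inj₁ c = trans (trans (sym (merge-off w≢s)) c) (trans (sym b) (merge-off z≢s))
          ... | inj₁ a | inj₁ b | _ = contradiction (trans (sym (merge-off z≢s)) (trans b (trans (sym a) (merge-off r≢s)))) z≢r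
          ... | inj₂ a | inj₂ b | _ = contradiction (trans (sym (merge-off z≢s)) (trans b (trans (sym a) (merge-off r≢s)))) z≢r
          ... | inj₁ a | _ | inj₁ b = contradiction (trans (sym (merge-off w≢s)) (trans b (trans (sym a) (merge-off r≢s)))) w≢r
          ... | inj₂ a | _ | inj₂ b = contradiction (trans (sym (merge-off w≢s)) (trans b (trans (sym a) (merge-off r≢s)))) w≢r
          only : ∀ {w} → E G y w → w ≡ r ⊎ w ≡ s ⊎ w ≡ z
          only {w} yw with w ≟ r | w ≟ s
          ... | yes e | _ = inj₁ e
          ... | no _ | yes e = inj₂ (inj₁ e)
          ... | no w≢r | no w≢s = inj₂ (inj₂ (same w≢r w≢s yw))

      -- After contracting s into r, the edge rx is dense again.
      attached : ∀ {x} → x ≢ r → x ≢ s → E G r x ⊎ E G s x → ⊥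
      attached {x} x≢r x≢s rx = ih (𝒞-contract sr G∈𝒞) (contract-supported {G = G} sr sup) (remove-shorter (sup sr) len) record
        { edge = rx′ rx ; deg = deg′ ; y₀≢r = proj₁ (proj₂ (proj₂ nbr)) ; y₀≢s = ≢-sym (E-irrefl G (proj₁ (proj₂ nbr))) ; y₀a₀ = E-sym (contract G s r) xa′ }
        where
        sr = E-sym G edge
        m = merge s r
        rx′ : E G r x ⊎ E G s x → E (contract G s r) r x
        rx′ (inj₁ e) = ≢-sym x≢r , r , x , e , merge-off r≢s , merge-off x≢s
        rx′ (inj₂ e) = ≢-sym x≢r , s , x , e , merge-at s r , merge-off x≢s
        nbr : ∃ λ a → E G x a × a ≢ r × a ≢ s
        nbr = deg x≢r x≢s (proj₂ (endpoint rx)) r s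
          where
          endpoint : E G r x ⊎ E G s x → ∃ (E G x)
          endpoint (inj₁ e) = r , E-sym G e
          endpoint (inj₂ e) = s , E-sym G e
        xa′ : E (contract G s r) x (proj₁ nbr)
        xa′ = E-irrefl G (proj₁ (proj₂ nbr)) , _ , _ , proj₁ (proj₂ nbr) , merge-off x≢s , merge-off (proj₂ (proj₂ (proj₂ nbr)))
        deg′ : ∀ {y a} → y ≢ r → y ≢ x → E (contract G s r) y a → Deg≥3 (contract G s r) y
        deg′ {y} y≢r y≢x (_ , y₀ , a₀ , e , p , _) u v
          with any? (λ z → E? (contract G s r) y z ×-dec ¬? (z ≟ u) ×-dec ¬? (z ≟ v))
        ... | yes found = found
        ... | no none = ⊥-elim (¬common-deg3 y≢r y≢s (subst (λ t → E G t a₀) y₀≡y e) few)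
          where
          y≢s : y ≢ s
          y≢s y≡s = merge≢ r≢s y₀ (trans p y≡s)
          y₀≡y : y₀ ≡ y
          y₀≡y with y₀ ≟ s
          ... | yes _ = contradiction (sym p) y≢r
          ... | no _  = p
          few : ∀ {w} → E (contract G s r) y w → w ≡ u ⊎ w ≡ v
          few {w} e′ with w ≟ u | w ≟ v
          ... | yes q | _ = inj₁ q
          ... | no _ | yes q = inj₂ q
          ... | no q | no q′ = contradiction (w , e′ , q , q′) none

      -- Here `rs` is a component of its own. Deleting `r` also isolates `s` and changes no other
      -- degree, so an edge `y₀b` can take over the role of `rs`, and a further neighbour `c` of
      -- `y₀` that of `y₀`.
      detached : (∀ {x} → x ≢ r → x ≢ s → E G r x ⊎ E G s x → ⊥) → ⊥
      detached isolated with deg y₀≢r y₀≢s y₀a₀ r s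
      ... | b , yb , b≢r , b≢s with deg y₀≢r y₀≢s y₀a₀ b b
      ...   | c , yc , c≢b , _ = ih {delete G r} {remove r vs} (𝒞-⊆ proj₁ G∈𝒞) (λ (e , u≢r , _) → ∈-remove (sup e) u≢r) (remove-shorter (sup edge) len) record
        { edge = yb , y₀≢r , b≢r
        ; deg = λ {w} _ _ (e , w≢r , a≢r) p q →
            let t , wt , t≢p , t≢q = deg w≢r (w≢s e a≢r) e p q in
            t , (wt , w≢r , t≢r w≢r (w≢s e a≢r) wt) , t≢p , t≢q
        ; y₀≢r = ≢-sym (E-irrefl G yc) ; y₀≢s = c≢b ; y₀a₀ = E-sym G yc , t≢r y₀≢r y₀≢s yc , y₀≢r }
        where
        w≢s : ∀ {w a} → E G w a → a ≢ r → w ≢ s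
        w≢s e a≢r refl = isolated a≢r (≢-sym (E-irrefl G e)) (inj₂ e)
        t≢r : ∀ {w t} → w ≢ r → w ≢ s → E G w t → t ≢ r
        t≢r w≢r w≢s e refl = isolated w≢r w≢s (inj₁ (E-sym G e))

      ¬dense-step : ⊥
      ¬dense-step = detached attached

    ¬dense : ∀ k → NoDense k
    ¬dense zero {vs = []} _ sup _ D with () ← sup (Dense.edge D)
    ¬dense (suc k) G∈𝒞 sup len D = ¬dense-step (¬dense k) G∈𝒞 sup len D

-- Edges in at most two triangles, and orientations with out-degrees at most 3.

module Orientations where

  open Minors
  open Degrees
  open import Data.Nat using (zero; suc; _+_; _∸_; _≤_; z≤n; s≤s)
  import Data.Nat.Properties as ℕP
  open import Data.Fin using (Fin; zero; suc)
  open import Data.Fin.Patterns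
  open import Data.Fin.Properties using (_≟_; any?; all?)
  open import Data.List as List using (List; []; _∷_; _++_; length; filter; map; take; drop; deduplicate; allFin)
  import Data.List.Properties as ListP
  open import Data.List.Membership.Propositional using (_∈_; _∉_; lose)
  open import Data.List.Membership.Propositional.Properties using (∈-filter⁺; ∈-filter⁻; ∈-map⁺; ∈-++⁺ˡ; ∈-++⁺ʳ; ∈-++⁻; ∈-deduplicate⁺; ∈-allFin)
  open import Data.List.Relation.Unary.Any using (here; there)
  import Data.List.Relation.Unary.All as All
  open import Data.List.Relation.Unary.AllPairs using ([]; _∷_)
  open import Data.List.Relation.Unary.Unique.Propositional using (Unique)
  import Data.List.Relation.Unary.Unique.Propositional.Properties as Unique
  open import Data.List.Relation.Unary.Unique.DecPropositional.Properties using (deduplicate-!)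
  open import Data.Sum as Sum using (_⊎_; inj₁; inj₂; [_,_]′)
  open import Data.Empty using (⊥-elim)
  open import Data.Product using (∃; ∃₂; _×_; _,_; proj₁; proj₂)
  open import Relation.Nullary using (¬_; Dec; yes; no; contradiction)
  open import Relation.Nullary.Decidable using (_×-dec_; _⊎-dec_; _→-dec_; ¬?)
  open import Relation.Unary using (Decidable)
  open import Relation.Binary.PropositionalEquality
  import Data.List.Membership.DecPropositional as DecMem
  import Data.Vec.Functional as VF

  cons-clique : ∀ {N k} (G : Graph N) (c : Fin k → Fin N) v → (∀ i → E G v (c i)) → Clique G c → Clique G (v VF.∷ c)
  cons-clique G c v vc K zero zero i≢j = contradiction refl i≢j
  cons-clique G c v vc K zero (suc j) _ = vc j
  cons-clique G c v vc K (suc i) zero _ = E-sym G (vc i)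
  cons-clique G c v vc K (suc i) (suc j) i≢j = K i j λ e → i≢j (cong suc e)

  module LightEdge {N} {G : Graph N} (D : Drawn G) (v : Fin N) where

    -- Only non-isolated vertices of `H` are joined to `v`. A contracted vertex is isolated, and so
    -- the cone over a contraction of `H` stays inside the contraction of the cone.
    cone : Graph N → Graph N
    cone H = record
      { E = λ u w → E H u w ⊎ (u ≡ v × w ≢ v × ∃ (E H w)) ⊎ (w ≡ v × u ≢ v × ∃ (E H u))
      ; E? = λ u w → E? H u w ⊎-dec (u ≟ v ×-dec ¬? (w ≟ v) ×-dec any? (E? H w)) ⊎-dec (w ≟ v ×-dec ¬? (u ≟ v) ×-dec any? (E? H u))
      ; E-sym = Sum.map (E-sym H) Sum.swap
      ; E-irrefl = λ { (inj₁ e) → E-irrefl H e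
                     ; (inj₂ (inj₁ (refl , w≢v , _))) → ≢-sym w≢v
                     ; (inj₂ (inj₂ (refl , u≢v , _))) → u≢v }
      }

    Linkable : Graph N → Set
    Linkable H = (∀ {a} → ¬ E H v a) × Drawn (cone H)

    linkable-⊆ : ∀ {H K} → H ⊆ K → Linkable K → Linkable H
    linkable-⊆ H⊆K (iso , d) = (λ e → iso (H⊆K e)) , Drawn-⊆ (λ
      { (inj₁ e) → inj₁ (H⊆K e)
      ; (inj₂ (inj₁ (p , q , a , e))) → inj₂ (inj₁ (p , q , a , H⊆K e))
      ; (inj₂ (inj₂ (p , q , a , e))) → inj₂ (inj₂ (p , q , a , H⊆K e)) }) d

    linkable-contract : ∀ {H x r} → E H x r → Linkable H → Linkable (contract H x r)
    linkable-contract {H} {x} {r} xr (iso , d) = iso′ , Drawn-⊆ into (Drawn-contract (inj₁ xr) d)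
      where
      ≢v : ∀ {a b} → E H a b → a ≢ v
      ≢v e refl = iso e
      v≢x = ≢-sym (≢v xr)
      merge≢v : ∀ {a b} → E H a b → merge x r a ≢ v
      merge≢v {a} e p with a ≟ x
      ... | yes _ = ≢v (E-sym H xr) p
      ... | no _  = ≢v e p
      iso′ : ∀ {a} → ¬ E (contract H x r) v a
      iso′ (_ , _ , _ , e , p , _) = merge≢v e p
      into : ∀ {u w} → E (cone (contract H x r)) u w → E (contract (cone H) x r) u w
      into (inj₁ (u≢w , u₀ , w₀ , e , p , q)) = u≢w , u₀ , w₀ , inj₁ e , p , q
      into (inj₂ (inj₁ (refl , w≢v , a , _ , w₀ , a₀ , e , p , _))) =
        ≢-sym w≢v , v , w₀ , inj₂ (inj₁ (refl , ≢v e , a₀ , e)) , merge-off v≢x , p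
      into (inj₂ (inj₂ (refl , w≢v , a , _ , w₀ , a₀ , e , p , _))) =
        w≢v , w₀ , v , inj₂ (inj₂ (refl , ≢v e , a₀ , e)) , p , merge-off v≢x

    linkable-¬K₄ : ∀ {H} → Linkable H → ∀ {a b c d} → ¬ K₄-at H a b c d
    linkable-¬K₄ {H} (iso , drawn) {a} {b} {c} {d} (ab , ac , ad , bc , bd , cd) = ¬K₅ drawn _
      (cons (a VF.∷ b VF.∷ c VF.∷ d VF.∷ VF.[]) v (λ { 0F → apex ab ; 1F → apex bc ; 2F → apex cd ; 3F → apex (E-sym H cd) })
      (cons (b VF.∷ c VF.∷ d VF.∷ VF.[]) a (λ { 0F → inj₁ ab ; 1F → inj₁ ac ; 2F → inj₁ ad })
      (cons (c VF.∷ d VF.∷ VF.[]) b (λ { 0F → inj₁ bc ; 1F → inj₁ bd })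
      (cons (d VF.∷ VF.[]) c (λ { 0F → inj₁ cd })
      (cons VF.[] d (λ ()) λ ())))))
      where
      cons : ∀ {k} (c : Fin k → Fin N) v → (∀ i → E (cone H) v (c i)) → Clique (cone H) c → Clique (cone H) (v VF.∷ c)
      cons = cons-clique (cone H)
      apex : ∀ {w z} → E H w z → E (cone H) v w
      apex e = inj₂ (inj₁ (refl , (λ { refl → iso e }) , _ , e))

    open MinorClosed Linkable (λ {H} {K} → linkable-⊆ {H} {K}) (λ {H} → linkable-contract {H}) (λ {H} → linkable-¬K₄ {H})

    link : Graph N
    link = record
      { E = λ u w → E G u w × E G v u × E G v w
      ; E? = λ u w → E? G u w ×-dec E? G v u ×-dec E? G v w
      ; E-sym = λ (e , p , q) → E-sym G e , q , p
      ; E-irrefl = λ (e , _) → E-irrefl G e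
      }

    link-linkable : Linkable link
    link-linkable = (λ (_ , e , _) → E-irrefl G e refl) , Drawn-⊆ (λ
      { (inj₁ (e , _)) → e
      ; (inj₂ (inj₁ (refl , _ , _ , _ , e , _))) → e
      ; (inj₂ (inj₂ (refl , _ , _ , _ , e , _))) → E-sym G e }) D

    LightAt : Fin N → Set
    LightAt x = E G v x × ∃₂ λ p q → ∀ z → E G v z × E G x z → z ≡ p ⊎ z ≡ q

    -- If no neighbour of `v` is light, each has degree at least 3 in the link, which is then dense
    -- along any of its edges.
    light-edge : ∀ {t} → E G v t → ∃ LightAt
    light-edge {t} vt with any? (λ x → E? G v x ×-dec any? λ p → any? λ q → all? λ z → (E? G v z ×-dec E? G x z) →-dec (z ≟ p ⊎-dec z ≟ q))
    ... | yes found = found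
    ... | no none = ⊥-elim (¬dense _ link-linkable (λ _ → ∈-allFin _) ℕP.≤-refl dense)
      where
      deg : ∀ {x} → E G v x → Deg≥3 link x
      deg {x} vx p q with any? (λ z → E? link x z ×-dec ¬? (z ≟ p) ×-dec ¬? (z ≟ q))
      ... | yes found = found
      ... | no few = contradiction (x , vx , p , q , only) none
        where
        only : ∀ z → E G v z × E G x z → z ≡ p ⊎ z ≡ q
        only z (vz , xz) with z ≟ p | z ≟ q
        ... | yes e | _ = inj₁ e
        ... | no _ | yes e = inj₂ e
        ... | no a | no b = contradiction (z , (xz , vx , vz) , a , b) few
      s = proj₁ (deg vt t t)
      ts = proj₁ (proj₂ (deg vt t t))
      y = proj₁ (deg vt s s)
      ty = proj₁ (proj₂ (deg vt s s))
      dense : Dense link t s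
      dense = record
        { edge = ts ; deg = λ _ _ (_ , vy , _) → deg vy
        ; y₀≢r = ≢-sym (E-irrefl link ty) ; y₀≢s = proj₁ (proj₂ (proj₂ (deg vt s s))) ; y₀a₀ = E-sym link ty }
  open LightEdge using (light-edge)

  -- The lists may contain repetitions and non-neighbours; only their lengths and the covering of
  -- every edge count.
  record Orientation {N} (G : Graph N) : Set where
    field
      out    : Fin N → List (Fin N)
      short  : ∀ v → length (out v) ≤ 3
      covers : ∀ {u v} → E G u v → v ∈ out u ⊎ u ∈ out v
  open Orientation public

  unique-length-≤ : ∀ {N} {xs ys : List (Fin N)} → Unique xs → (∀ {z} → z ∈ xs → z ∈ ys) → length xs ≤ length ys
  unique-length-≤ [] _ = z≤n
  unique-length-≤ {xs = x ∷ xs} {ys} (x∉xs ∷ u) sub = ℕP.≤-trans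
    (s≤s (unique-length-≤ u λ z∈xs → ∈-remove (sub (there z∈xs)) (≢-sym (All.lookup x∉xs z∈xs))))
    (ListP.filter-notAll (λ v → ¬? (v ≟ x)) ys (lose (sub (here refl)) λ x≢x → x≢x refl))

  filter-inclusion-exclusion : ∀ {A : Set} {P Q : A → Set} (P? : Decidable P) (Q? : Decidable Q) xs →
    length (filter P? xs) + length (filter Q? xs) ≤ length xs + length (filter (λ x → P? x ×-dec Q? x) xs)
  filter-inclusion-exclusion P? Q? [] = z≤n
  filter-inclusion-exclusion P? Q? (x ∷ xs) with filter-inclusion-exclusion P? Q? xs | P? x | Q? x
  ... | ih | yes _ | yes _ = s≤s (subst₂ _≤_ (sym (ℕP.+-suc _ _)) (sym (ℕP.+-suc _ _)) (s≤s ih))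
  ... | ih | yes _ | no _  = s≤s ih
  ... | ih | no _  | yes _ = ℕP.≤-trans (ℕP.≤-reflexive (ℕP.+-suc _ _)) (s≤s ih)
  ... | ih | no _  | no _  = ℕP.m≤n⇒m≤1+n ih

  -- The first part is filled up to the capacity `c`; by the bound on the total, what remains fits
  -- into the second.
  split-by-room : ∀ {A : Set} {a b c} (xs : List A) → a ≤ c → b ≤ c → (a + b) + length xs ≤ c + c →
    ∃₂ λ ys zs → ys ++ zs ≡ xs × a + length ys ≤ c × b + length zs ≤ c
  split-by-room {a = a} {b} {c} xs a≤c b≤c total =
    take k xs , drop k xs , ListP.take++drop≡id k xs ,
    ℕP.≤-trans (ℕP.+-monoʳ-≤ a (ℕP.≤-trans (ℕP.≤-reflexive (ListP.length-take k xs)) (ℕP.m⊓n≤m k (length xs))))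
      (ℕP.≤-reflexive (ℕP.m+[n∸m]≡n a≤c)) ,
    subst (λ l → b + l ≤ c) (sym (ListP.length-drop k xs)) (rest (ℕP.≤-total (length xs) k))
    where
    k = c ∸ a
    rest : length xs ≤ k ⊎ k ≤ length xs → b + (length xs ∸ k) ≤ c
    rest (inj₁ l≤k) = subst (λ l → b + l ≤ c) (sym (ℕP.m≤n⇒m∸n≡0 l≤k)) (subst (_≤ c) (sym (ℕP.+-identityʳ b)) b≤c)
    rest (inj₂ k≤l) = ℕP.+-cancelˡ-≤ c (b + (length xs ∸ k)) c (begin
      c + (b + l)           ≡⟨ cong (_+ (b + l)) (sym (ℕP.m+[n∸m]≡n a≤c)) ⟩
      (a + k) + (b + l)     ≡⟨ ℕP.+-assoc a k (b + l) ⟩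
      a + (k + (b + l))     ≡⟨ cong (a +_) (trans (sym (ℕP.+-assoc k b l)) (trans (cong (_+ l) (ℕP.+-comm k b)) (ℕP.+-assoc b k l))) ⟩
      a + (b + (k + l))     ≡⟨ cong (λ t → a + (b + t)) (ℕP.m+[n∸m]≡n k≤l) ⟩
      a + (b + length xs)   ≡⟨ sym (ℕP.+-assoc a b (length xs)) ⟩
      (a + b) + length xs   ≤⟨ total ⟩
      c + c                 ∎)
      where
      open ℕP.≤-Reasoning
      l = length xs ∸ k

  module Uncontract {N} {G : Graph N} {v x p q : Fin N} (vx : E G v x)
    (light : ∀ z → E G v z × E G x z → z ≡ p ⊎ z ≡ q) (o : Orientation (contract G x v)) where

    open DecMem (_≟_ {n = N}) using (_∈?_)

    common? : ∀ z → Dec (E G v z × E G x z)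
    common? z = E? G v z ×-dec E? G x z

    v≢x = E-irrefl G vx

    -- Repetitions are removed since the common neighbours in this list are about to be counted.
    old : List (Fin N)
    old = deduplicate _≟_ (out o v)

    old-short : length old ≤ 3
    old-short = ℕP.≤-trans (ListP.length-deduplicate _≟_ (out o v)) (short o v)

    candidates : List (Fin N)
    candidates = deduplicate _≟_ (p ∷ q ∷ [])

    ∈-pq : ∀ {z} → E G v z × E G x z → z ∈ p ∷ q ∷ []
    ∈-pq {z} c with light z c
    ... | inj₁ refl = here refl
    ... | inj₂ refl = there (here refl)

    -- The edges from these to the merged vertex split into two, one of which must be reversed.
    incoming : List (Fin N)
    incoming = filter (λ z → ¬? (z ∈? old)) (filter common? candidates)

    ∈-incoming : ∀ {z} → E G v z → E G x z → z ∉ old → z ∈ incoming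
    ∈-incoming vz xz z∉ = ∈-filter⁺ (λ z → ¬? (z ∈? old)) (∈-filter⁺ common? (∈-deduplicate⁺ _≟_ (∈-pq (vz , xz))) (vz , xz)) z∉

    incoming⁻ : ∀ {z} → z ∈ incoming → (E G v z × E G x z) × z ∉ old
    incoming⁻ z∈ = let z∈′ , z∉ = ∈-filter⁻ (λ z → ¬? (z ∈? old)) {xs = filter common? candidates} z∈ in
      proj₂ (∈-filter⁻ common? {xs = candidates} z∈′) , z∉

    few-common : length (filter common? old) + length incoming ≤ 2
    few-common = subst (_≤ 2) (ListP.length-++ (filter common? old)) (unique-length-≤ {ys = p ∷ q ∷ []}
      (Unique.++⁺ (Unique.filter⁺ common? (deduplicate-! _≟_ (out o v)))
        (Unique.filter⁺ (λ z → ¬? (z ∈? old)) (Unique.filter⁺ common? (deduplicate-! _≟_ (p ∷ q ∷ []))))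
        (λ (a , b) → proj₂ (incoming⁻ b) (proj₁ (∈-filter⁻ common? {xs = old} a))))
      (λ z∈ → ∈-pq ([ (λ a → proj₂ (∈-filter⁻ common? {xs = old} a)) , (λ b → proj₁ (incoming⁻ b)) ]′ (∈-++⁻ (filter common? old) z∈))))

    kept-v kept-x extra : List (Fin N)
    kept-v = filter (E? G v) old
    kept-x = filter (E? G x) old
    -- The entry x stands for the edge vx itself.
    extra = x ∷ incoming

    -- The merged vertex has at most 3 out-neighbours. A common neighbour of `v` and `x` among them
    -- takes a second place, one outside them a new place, which makes at most 2 together; the edge
    -- `vx` takes one more. Hence 3 + 2 + 1 places, and `v` and `x` offer 3 each.
    room : (length kept-v + length kept-x) + length extra ≤ 3 + 3
    room = begin
      (length kept-v + length kept-x) + suc (length incoming)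
        ≤⟨ ℕP.+-monoˡ-≤ (suc (length incoming)) (filter-inclusion-exclusion (E? G v) (E? G x) old) ⟩
      (length old + c) + suc (length incoming)   ≡⟨ ℕP.+-assoc (length old) c (suc (length incoming)) ⟩
      length old + (c + suc (length incoming))   ≡⟨ cong (length old +_) (ℕP.+-suc c (length incoming)) ⟩
      length old + suc (c + length incoming)     ≤⟨ ℕP.+-mono-≤ old-short (s≤s few-common) ⟩
      3 + 3 ∎
      where
      open ℕP.≤-Reasoning
      c = length (filter common? old)

    split = split-by-room extra
      (ℕP.≤-trans (ListP.length-filter (E? G v) old) old-short) (ℕP.≤-trans (ListP.length-filter (E? G x) old) old-short) room

    extra-v extra-x : List (Fin N)
    extra-v = proj₁ split
    extra-x = proj₁ (proj₂ split)

    split-extra : ∀ {z} → z ∈ extra → z ∈ extra-v ⊎ z ∈ extra-x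
    split-extra z∈ = ∈-++⁻ extra-v (subst (_ ∈_) (sym (proj₁ (proj₂ (proj₂ split)))) z∈)

    -- Which of v and x replaces the merged vertex as an out-neighbour of w.
    head : Fin N → Fin N
    head w with E? G x w ×-dec (¬? (E? G v w) ⊎-dec w ∈? extra-v)
    ... | yes _ = x
    ... | no _  = v

    head-v : ∀ {w} → E G v w → w ∉ extra-v → head w ≡ v
    head-v {w} vw w∉ with E? G x w ×-dec (¬? (E? G v w) ⊎-dec w ∈? extra-v)
    ... | yes (_ , inj₁ ¬vw) = contradiction vw ¬vw
    ... | yes (_ , inj₂ w∈)  = contradiction w∈ w∉
    ... | no _  = refl

    head-x : ∀ {w} → E G x w → ¬ E G v w ⊎ w ∈ extra-v → head w ≡ x
    head-x {w} xw h with E? G x w ×-dec (¬? (E? G v w) ⊎-dec w ∈? extra-v)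
    ... | yes _ = refl
    ... | no ¬h = contradiction (xw , h) ¬h

    out′ : Fin N → List (Fin N)
    out′ w with w ≟ v | w ≟ x
    ... | yes _ | _     = kept-v ++ extra-v
    -- If the entry for the edge `vx` falls to `x`, renaming makes it point to `v`.
    ... | no _  | yes _ = kept-x ++ map (merge x v) extra-x
    ... | no _  | no _  = map (merge v (head w)) (out o w)

    short′ : ∀ w → length (out′ w) ≤ 3
    short′ w with w ≟ v | w ≟ x
    ... | yes _ | _     = ℕP.≤-trans (ℕP.≤-reflexive (ListP.length-++ kept-v)) (proj₁ (proj₂ (proj₂ (proj₂ split))))
    ... | no _  | yes _ = ℕP.≤-trans (ℕP.≤-reflexive (trans (ListP.length-++ kept-x) (cong (length kept-x +_) (ListP.length-map (merge x v) extra-x))))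
                            (proj₂ (proj₂ (proj₂ (proj₂ split))))
    ... | no _  | no _  = subst (_≤ 3) (sym (ListP.length-map (merge v (head w)) (out o w))) (short o w)

    ∈-out-v : ∀ {z} → z ∈ kept-v ++ extra-v → z ∈ out′ v
    ∈-out-v z∈ with v ≟ v
    ... | yes _  = z∈
    ... | no v≢v = contradiction refl v≢v

    ∈-out-x : ∀ {z} → z ∈ kept-x ++ map (merge x v) extra-x → z ∈ out′ x
    ∈-out-x z∈ with x ≟ v | x ≟ x
    ... | yes x≡v | _ = contradiction (sym x≡v) v≢x
    ... | no _ | yes _  = z∈
    ... | no _ | no x≢x = contradiction refl x≢x

    ∈-out-other : ∀ {w z} → w ≢ v → w ≢ x → z ∈ map (merge v (head w)) (out o w) → z ∈ out′ w
    ∈-out-other {w} w≢v w≢x z∈ with w ≟ v | w ≟ x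
    ... | yes w≡v | _     = contradiction w≡v w≢v
    ... | no _  | yes w≡x = contradiction w≡x w≢x
    ... | no _  | no _    = z∈

    v∈out⇒head∈out : ∀ {w} → w ≢ v → w ≢ x → v ∈ out o w → head w ∈ out′ w
    v∈out⇒head∈out {w} w≢v w≢x v∈ = ∈-out-other w≢v w≢x (subst (_∈ map (merge v (head w)) (out o w)) (merge-at v (head w)) (∈-map⁺ (merge v (head w)) v∈))

    covers-vx : x ∈ out′ v ⊎ v ∈ out′ x
    covers-vx = Sum.map (λ x∈ → ∈-out-v (∈-++⁺ʳ kept-v x∈))
      (λ x∈ → ∈-out-x (∈-++⁺ʳ kept-x (subst (_∈ map (merge x v) extra-x) (merge-at x v) (∈-map⁺ (merge x v) x∈)))) (split-extra (here refl))

    covers-v : ∀ {w} → w ≢ v → w ≢ x → E G v w → w ∈ out′ v ⊎ v ∈ out′ w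
    covers-v {w} w≢v w≢x vw with covers o {v} {w} (≢-sym w≢v , v , w , vw , merge-off v≢x , merge-off w≢x)
    ... | inj₁ w∈ = inj₁ (∈-out-v (∈-++⁺ˡ (∈-filter⁺ (E? G v) (∈-deduplicate⁺ _≟_ w∈) vw)))
    ... | inj₂ v∈ with w ∈? extra-v
    ...   | yes w∈ = inj₁ (∈-out-v (∈-++⁺ʳ kept-v w∈))
    ...   | no w∉  = inj₂ (subst (_∈ out′ w) (head-v vw w∉) (v∈out⇒head∈out w≢v w≢x v∈))

    covers-x : ∀ {w} → w ≢ v → w ≢ x → E G x w → w ∈ out′ x ⊎ x ∈ out′ w
    covers-x {w} w≢v w≢x xw with w ∈? old
    ... | yes w∈ = inj₁ (∈-out-x (∈-++⁺ˡ (∈-filter⁺ (E? G x) w∈ xw)))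
    ... | no w∉ with covers o {v} {w} (≢-sym w≢v , x , w , xw , merge-at x v , merge-off w≢x)
    ...   | inj₁ w∈ = contradiction (∈-deduplicate⁺ _≟_ w∈) w∉
    ...   | inj₂ v∈ with E? G v w
    ...     | no ¬vw = inj₂ (subst (_∈ out′ w) (head-x xw (inj₁ ¬vw)) (v∈out⇒head∈out w≢v w≢x v∈))
    ...     | yes vw with split-extra (there (∈-incoming vw xw w∉))
    ...       | inj₁ w∈ = inj₂ (subst (_∈ out′ w) (head-x xw (inj₂ w∈)) (v∈out⇒head∈out w≢v w≢x v∈))
    ...       | inj₂ w∈ = inj₁ (∈-out-x (∈-++⁺ʳ kept-x (subst (_∈ map (merge x v) extra-x) (merge-off w≢x) (∈-map⁺ (merge x v) w∈))))

    covers-other : ∀ {u w} → u ≢ v → u ≢ x → w ≢ v → w ≢ x → E G u w → w ∈ out′ u ⊎ u ∈ out′ w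
    covers-other {u} {w} u≢v u≢x w≢v w≢x uw = Sum.map (keep u≢v u≢x w≢v) (keep w≢v w≢x u≢v)
      (covers o (E-irrefl G uw , u , w , uw , merge-off u≢x , merge-off w≢x))
      where
      keep : ∀ {a b} → a ≢ v → a ≢ x → b ≢ v → b ∈ out o a → b ∈ out′ a
      keep {a} {b} a≢v a≢x b≢v b∈ = ∈-out-other a≢v a≢x (subst (_∈ map (merge v (head a)) (out o a)) (merge-off b≢v) (∈-map⁺ (merge v (head a)) b∈))

    covers′ : ∀ {u w} → E G u w → w ∈ out′ u ⊎ u ∈ out′ w
    covers′ {u} {w} uw = go (u ≟ v) (u ≟ x) (w ≟ v) (w ≟ x)
      where
      go : Dec (u ≡ v) → Dec (u ≡ x) → Dec (w ≡ v) → Dec (w ≡ x) → w ∈ out′ u ⊎ u ∈ out′ w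
      go (yes refl) _ _ (yes refl) = covers-vx
      go (yes refl) _ (yes refl) _ = contradiction refl (E-irrefl G uw)
      go (yes refl) _ (no a) (no b) = covers-v a b uw
      go _ (yes refl) (yes refl) _ = Sum.swap covers-vx
      go _ (yes refl) _ (yes refl) = contradiction refl (E-irrefl G uw)
      go _ (yes refl) (no a) (no b) = covers-x a b uw
      go (no a) (no b) (yes refl) _ = Sum.swap (covers-v a b (E-sym G uw))
      go (no a) (no b) _ (yes refl) = Sum.swap (covers-x a b (E-sym G uw))
      go (no a) (no b) (no c) (no d) = covers-other a b c d uw

    uncontract : Orientation G
    uncontract = record { out = out′ ; short = short′ ; covers = covers′ }

  orient-supported : ∀ {N} k {G : Graph N} {vs} → Drawn G → Supported G vs → length vs ≤ k → Orientation G
  orient-supported k {G} D sup len with any? (λ v → any? (E? G v))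
  orient-supported k {G} D sup len | no none = record { out = λ _ → [] ; short = λ _ → z≤n ; covers = λ e → contradiction (_ , _ , e) none }
  orient-supported zero {vs = []} D sup len | yes (v , t , vt) with () ← sup vt
  orient-supported (suc k) {G} D sup len | yes (v , t , vt) with light-edge D v vt
  ... | x , vx , p , q , light = Uncontract.uncontract vx light
    (orient-supported k (Drawn-contract (E-sym G vx) D) (contract-supported {G = G} (E-sym G vx) sup) (remove-shorter (sup (E-sym G vx)) len))

  orient : ∀ {N} {G : Graph N} → Drawn G → Orientation G
  orient D = orient-supported _ {vs = allFin _} D (λ _ → ∈-allFin _) ℕP.≤-refl

-- Monomials of the graph polynomial, and part (i).

module Coefficients where

  open Plane
  open Segments
  open Arcs
  open Minors
  open Orientations
  open import Data.Nat as ℕ using (ℕ; zero; suc; _≤_; _<_; s≤s)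
  import Data.Nat.Properties as ℕP
  open import Data.Integer as ℤ using (ℤ; +_; -[1+_]; 0ℤ; 1ℤ)
  import Data.Integer.Properties as ℤP
  open import Algebra.Properties.CommutativeSemigroup ℤP.*-commutativeSemigroup using (interchange)
  open import Data.Sign using () renaming (+ to plus; - to minus)
  open import Data.Fin using (Fin; zero; suc; toℕ)
  open import Data.Fin.Properties using (_≟_; any?)
  open import Data.Vec as Vec using (Vec; []; _∷_)
  import Data.Vec.Properties as VecP
  open import Data.Vec.Relation.Unary.All as VAll using ([]; _∷_)
  open import Data.Product.Properties using (≡-dec)
  open import Data.List as List using (List; []; _∷_; length; map; foldr; reverse)
  import Data.List.Properties as ListP
  open import Data.List.Membership.Propositional using (_∈_)
  open import Data.List.Membership.Propositional.Properties using (∈-map⁺; ∈-map⁻; ∈-++⁺ˡ; ∈-++⁺ʳ; ∈-++⁻; ∈-lookup)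
  open import Data.List.Relation.Unary.Any as Any using (here; there)
  import Data.List.Relation.Unary.Any.Properties as AnyP
  open import Data.List.Relation.Unary.All as All using (All; []; _∷_)
  open import Data.List.Relation.Unary.AllPairs using ([]; _∷_)
  open import Data.List.Relation.Unary.Unique.Propositional using (Unique)
  open import Data.Sum as Sum using (_⊎_; inj₁; inj₂; [_,_]′)
  open import Data.Empty using (⊥)
  open import Data.Product using (Σ; ∃; _×_; _,_; proj₁; proj₂)
  open import Relation.Nullary using (yes; no; contradiction)
  open import Relation.Nullary.Decidable using (_⊎-dec_)
  open import Relation.Binary.PropositionalEquality

  evalMono : ∀ {N} → (Fin N → ℤ) → Monomial N → ℤ
  evalMono x []      = 1ℤ
  evalMono x (k ∷ t) = x zero ℤ.^ k ℤ.* evalMono (λ i → x (suc i)) t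

  evalMono-* : ∀ {N} (x : Fin N → ℤ) s t → evalMono x (Vec.zipWith ℕ._+_ s t) ≡ evalMono x s ℤ.* evalMono x t
  evalMono-* x [] [] = refl
  evalMono-* x (j ∷ s) (k ∷ t) = trans
    (cong₂ ℤ._*_ (ℤP.^-distribˡ-+-* (x zero) j k) (evalMono-* (λ i → x (suc i)) s t))
    (interchange (x zero ℤ.^ j) (x zero ℤ.^ k) (evalMono (λ i → x (suc i)) s) (evalMono (λ i → x (suc i)) t))

  evalMono-unit : ∀ {N} (x : Fin N → ℤ) → evalMono x unitMono ≡ 1ℤ
  evalMono-unit {zero}  x = refl
  evalMono-unit {suc N} x = trans (ℤP.*-identityˡ _) (evalMono-unit (λ i → x (suc i)))

  evalMono-var : ∀ {N} (x : Fin N → ℤ) v → evalMono x (varMono v) ≡ x v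
  evalMono-var x zero    = trans (cong₂ ℤ._*_ (ℤP.^-identityʳ (x zero)) (evalMono-unit (λ i → x (suc i)))) (ℤP.*-identityʳ (x zero))
  evalMono-var x (suc v) = trans (ℤP.*-identityˡ _) (evalMono-var (λ i → x (suc i)) v)

  edgesPoly : ∀ {N} → List (Edge N) → Poly N
  edgesPoly = foldr (λ e p → polyMul (edgeFactor e) p) onePoly

  Constant : ∀ {N} → (Fin N → ℤ) → ℤ → Poly N → Set
  Constant x K p = ∀ {c t} → (c , t) ∈ p → c ℤ.* evalMono x t ≡ K

  mulTerm : ∀ {N} → ℤ × Monomial N → ℤ × Monomial N → ℤ × Monomial N
  mulTerm (c , s) (d , t) = c ℤ.* d , Vec.zipWith ℕ._+_ s t

  ∈-edge-* : ∀ {N u v s} {b : ℤ × Monomial N} {p} → b ∈ polyMul (edgeFactor (u , v , s)) p →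
    ∃ λ a → a ∈ p × (b ≡ mulTerm (+ 1 , varMono u) a ⊎ b ≡ mulTerm (ℤ.- (s · (+ 1)) , varMono v) a)
  ∈-edge-* {u = u} {v} {s} {p = p} b∈ with ∈-++⁻ (map (mulTerm (+ 1 , varMono u)) p) b∈
  ... | inj₁ h = let a , a∈ , e = ∈-map⁻ (mulTerm (+ 1 , varMono u)) h in a , a∈ , inj₁ e
  ... | inj₂ h with ∈-++⁻ (map (mulTerm (ℤ.- (s · (+ 1)) , varMono v)) p) h
  ...   | inj₁ h′ = let a , a∈ , e = ∈-map⁻ (mulTerm (ℤ.- (s · (+ 1)) , varMono v)) h′ in a , a∈ , inj₂ e

  ∈-edge-*ˡ : ∀ {N u v s} {a : ℤ × Monomial N} {p} → a ∈ p → mulTerm (+ 1 , varMono u) a ∈ polyMul (edgeFactor (u , v , s)) p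
  ∈-edge-*ˡ {u = u} a∈ = ∈-++⁺ˡ (∈-map⁺ (mulTerm (+ 1 , varMono u)) a∈)

  ∈-edge-*ʳ : ∀ {N u v s} {a : ℤ × Monomial N} {p} → a ∈ p → mulTerm (ℤ.- (s · (+ 1)) , varMono v) a ∈ polyMul (edgeFactor (u , v , s)) p
  ∈-edge-*ʳ {u = u} {v} {s} {p = p} a∈ = ∈-++⁺ʳ (map (mulTerm (+ 1 , varMono u)) p) (∈-++⁺ˡ (∈-map⁺ (mulTerm (ℤ.- (s · (+ 1)) , varMono v)) a∈))

  data Unit : ℤ → Set where
    one      : Unit (+ 1)
    minusOne : Unit -[1+ 0 ]

  InM2⇒Unit : ∀ {x} → InM 2 x → Unit x
  InM2⇒Unit {+ 0} (inj₁ x≢0 , _) = contradiction refl x≢0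
  InM2⇒Unit {+ 1} _ = one
  InM2⇒Unit { + suc (suc k)} (_ , s≤s (s≤s le)) with () ← subst (_≤ 0) (ℕP.+-suc k (suc (k ℕ.+ 0))) le
  InM2⇒Unit { -[1+ 0 ]} _ = minusOne
  InM2⇒Unit { -[1+ suc k ]} (_ , s≤s (s≤s le)) with () ← subst (_≤ 0) (ℕP.+-suc k (suc (k ℕ.+ 0))) le

  Unit⇒≢0 : ∀ {x} → Unit x → x ≢ 0ℤ
  Unit⇒≢0 one      ()
  Unit⇒≢0 minusOne ()

  -- The two terms of the factor of a properly coloured edge have the same value at the colouring.
  edge-balanced : ∀ {x y} s → Unit x → Unit y → x ≢ s · y → ℤ.- (s · (+ 1)) ℤ.* y ≡ x
  edge-balanced plus  one      one      ne = contradiction refl ne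
  edge-balanced plus  one      minusOne ne = refl
  edge-balanced plus  minusOne one      ne = refl
  edge-balanced plus  minusOne minusOne ne = contradiction refl ne
  edge-balanced minus one      one      ne = refl
  edge-balanced minus one      minusOne ne = contradiction refl ne
  edge-balanced minus minusOne one      ne = contradiction refl ne
  edge-balanced minus minusOne minusOne ne = refl

  module Balanced {N} (x : Fin N → ℤ) (unit : ∀ v → Unit (x v)) where

    value : List (Edge N) → ℤ
    value = foldr (λ (u , _) k → x u ℤ.* k) 1ℤ

    value≢0 : ∀ es → value es ≢ 0ℤ
    value≢0 [] ()
    value≢0 ((u , _) ∷ es) e = [ Unit⇒≢0 (unit u) , value≢0 es ]′ (ℤP.i*j≡0⇒i≡0∨j≡0 (x u) e)

    edgesPoly-constant : ∀ es → All (λ (u , v , s) → x u ≢ s · x v) es → Constant x (value es) (edgesPoly es)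
    edgesPoly-constant [] [] (here refl) = trans (ℤP.*-identityˡ _) (evalMono-unit x)
    edgesPoly-constant ((u , v , s) ∷ es) (ne ∷ nes) b∈ with ∈-edge-* {u = u} {v} {s} {p = edgesPoly es} b∈
    ... | (c , t) , a∈ , inj₁ refl = trans
          (cong (λ z → (1ℤ ℤ.* c) ℤ.* z) (trans (evalMono-* x (varMono u) t) (cong (ℤ._* evalMono x t) (evalMono-var x u))))
          (trans (interchange 1ℤ c (x u) (evalMono x t)) (cong₂ ℤ._*_ (ℤP.*-identityˡ (x u)) (edgesPoly-constant es nes a∈)))
    ... | (c , t) , a∈ , inj₂ refl = trans
          (cong (λ z → (ℤ.- (s · (+ 1)) ℤ.* c) ℤ.* z) (trans (evalMono-* x (varMono v) t) (cong (ℤ._* evalMono x t) (evalMono-var x v))))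
          (trans (interchange (ℤ.- (s · (+ 1))) c (x v) (evalMono x t))
            (cong₂ ℤ._*_ (edge-balanced s (unit u) (unit v) ne) (edgesPoly-constant es nes a∈)))

  -- `k` counts the occurrences of `t` in the unnormalised list of terms. Each of them contributes
  -- the same value `K`, so they cannot cancel.
  coeff-constant : ∀ {N} (x : Fin N → ℤ) {K} (p : Poly N) t → Constant x K p →
    Σ ℕ λ k → coeff p t ℤ.* evalMono x t ≡ + k ℤ.* K × (∀ {c} → (c , t) ∈ p → k ≢ 0)
  coeff-constant x [] t const = 0 , refl , λ ()
  coeff-constant x {K} ((c , s) ∷ p) t const with coeff-constant x {K} p t (λ a∈ → const (there a∈)) | VecP.≡-dec ℕP._≟_ s t
  ... | k , e , occ | yes refl = suc k ,
        trans (ℤP.*-distribʳ-+ (evalMono x t) c (coeff p t)) (trans (cong₂ ℤ._+_ (const (here refl)) e) (sym (ℤP.suc-* (+ k) K))) , λ _ ()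
  ... | k , e , occ | no s≢t = k , trans (cong (ℤ._* evalMono x t) (ℤP.+-identityˡ (coeff p t))) e ,
        λ { (here refl) → contradiction refl s≢t ; (there h) → occ h }

  coeff≢0 : ∀ {N} (x : Fin N → ℤ) {K} (p : Poly N) {c t} → K ≢ 0ℤ → Constant x K p → (c , t) ∈ p → coeff p t ≢ 0ℤ
  coeff≢0 x p {t = t} K≢0 const t∈ c≡0 with coeff-constant x p t const
  ... | k , e , occ with ℤP.i*j≡0⇒i≡0∨j≡0 (+ k) (trans (sym e) (cong (ℤ._* evalMono x t) c≡0))
  ...   | inj₁ k≡0 = occ t∈ (ℤP.+-injective k≡0)
  ...   | inj₂ K≡0 = K≢0 K≡0

  Joins : ∀ {N} → Edge N → Fin N → Fin N → Set
  Joins e u v = ends e ≡ (u , v) ⊎ ends e ≡ (v , u)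

  Ordered : ∀ {N} → Edge N → Set
  Ordered e = toℕ (proj₁ e) < toℕ (proj₁ (proj₂ e))

  Joins-unique : ∀ {N} {e f : Edge N} {u v} → Ordered e → Ordered f → Joins e u v → Joins f u v → ends e ≡ ends f
  Joins-unique lt lt′ (inj₁ p) (inj₁ q) = trans p (sym q)
  Joins-unique lt lt′ (inj₂ p) (inj₂ q) = trans p (sym q)
  Joins-unique lt lt′ (inj₁ refl) (inj₂ refl) = contradiction lt′ (ℕP.<-asym lt)
  Joins-unique lt lt′ (inj₂ refl) (inj₁ refl) = contradiction lt′ (ℕP.<-asym lt)

  module Tails {N} (out : Fin N → List (Fin N)) where

    -- A term of the product picks one end of each edge as its tail, and the exponent of `w` is the
    -- number of edges with tail `w`. The heads of these edges are kept because, being distinct and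
    -- inside `out w`, they bound the exponent by the length of `out w`.
    record Choice (es : List (Edge N)) : Set where
      field
        {c}    : ℤ
        t      : Monomial N
        term   : (c , t) ∈ edgesPoly es
        heads  : Fin N → List (Fin N)
        count  : ∀ w → length (heads w) ≡ Vec.lookup t w
        ⊆out   : ∀ {w h} → h ∈ heads w → h ∈ out w
        unique : ∀ w → Unique (heads w)
        joined : ∀ {w h} → h ∈ heads w → ∃ λ e → e ∈ es × Joins e w h

    module Extend {e : Edge N} {es} (ord : Ordered e) (ords : All Ordered es) (fresh : All (λ f → ends e ≢ ends f) es) (C : Choice es)
      {w h} (e-wh : Joins e w h) (h∈out : h ∈ out w) where
      open Choice C

      heads′ : Fin N → List (Fin N)
      heads′ w′ with w′ ≟ w
      ... | yes _ = h ∷ heads w′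
      ... | no _  = heads w′

      count′ : ∀ w′ → length (heads′ w′) ≡ Vec.lookup (Vec.zipWith ℕ._+_ (varMono w) t) w′
      count′ w′ with w′ ≟ w
      ... | yes refl = trans (cong suc (count w)) (sym (trans (VecP.lookup-zipWith ℕ._+_ w (varMono w) t)
              (cong (ℕ._+ Vec.lookup t w) (VecP.lookup∘updateAt w unitMono))))
      ... | no w′≢w = trans (count w′) (sym (trans (VecP.lookup-zipWith ℕ._+_ w′ (varMono w) t)
              (cong (ℕ._+ Vec.lookup t w′) (trans (VecP.lookup∘updateAt′ w′ w w′≢w unitMono) (VecP.lookup-replicate w′ 0)))))

      ⊆out′ : ∀ {w′ h′} → h′ ∈ heads′ w′ → h′ ∈ out w′
      ⊆out′ {w′} h∈ with w′ ≟ w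
      ⊆out′ (here refl) | yes refl = h∈out
      ⊆out′ (there h∈)  | yes refl = ⊆out h∈
      ⊆out′ h∈          | no _     = ⊆out h∈

      unique′ : ∀ w′ → Unique (heads′ w′)
      unique′ w′ with w′ ≟ w
      ... | yes refl = All.tabulate (λ { {h′} h′∈ refl → new h′∈ }) ∷ unique w
        where
        -- A second edge between `w` and `h` would, by the ordering of ends, have the same pair of
        -- ends as `e`, against simplicity.
        new : h ∈ heads w → ⊥
        new h∈ with joined h∈
        ... | f , f∈ , j = All.lookup fresh f∈ (Joins-unique {e = e} {f} ord (All.lookup ords f∈) e-wh j)
      ... | no _ = unique w′

      joined′ : ∀ {w′ h′} → h′ ∈ heads′ w′ → ∃ λ f → f ∈ e ∷ es × Joins f w′ h′
      joined′ {w′} h∈ with w′ ≟ w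
      joined′ (here refl) | yes refl = e , here refl , e-wh
      joined′ (there h∈)  | yes refl = let f , f∈ , j = joined h∈ in f , there f∈ , j
      joined′ h∈          | no _     = let f , f∈ , j = joined h∈ in f , there f∈ , j

      extend : ∀ {a} → (a ℤ.* c , Vec.zipWith ℕ._+_ (varMono w) t) ∈ edgesPoly (e ∷ es) → Choice (e ∷ es)
      extend term′ = record { t = Vec.zipWith ℕ._+_ (varMono w) t ; term = term′ ; heads = heads′ ; count = count′ ; ⊆out = ⊆out′
                            ; unique = unique′ ; joined = joined′ }

    choose : ∀ es → All Ordered es → Unique (map ends es) →
      (∀ {u v s} → (u , v , s) ∈ es → v ∈ out u ⊎ u ∈ out v) → Choice es
    choose [] _ _ _ = record { t = unitMono ; term = here refl ; heads = λ _ → [] ; count = λ w → sym (VecP.lookup-replicate w 0)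
                             ; ⊆out = λ () ; unique = λ _ → [] ; joined = λ () }
    choose ((u , v , s) ∷ es) (ord ∷ ords) (fresh ∷ simple) covers with covers (here refl)
    ... | inj₁ v∈ = extend {+ 1} (∈-edge-*ˡ {u = u} {v} {s} (Choice.term C))
      where
      C = choose es ords simple λ e∈ → covers (there e∈)
      open Extend {e = u , v , s} ord ords (All.tabulate λ f∈ → All.lookup fresh (∈-map⁺ ends f∈)) C (inj₁ refl) v∈
    ... | inj₂ u∈ = extend {ℤ.- (s · (+ 1))} (∈-edge-*ʳ {u = u} {v} {s} (Choice.term C))
      where
      C = choose es ords simple λ e∈ → covers (there e∈)
      open Extend {e = u , v , s} ord ords (All.tabulate λ f∈ → All.lookup fresh (∈-map⁺ ends f∈)) C (inj₂ refl) u∈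

  onPoly-reverse : ∀ p a cs b → OnPoly p b (reverse cs) a → OnPoly p a cs b
  onPoly-reverse p a [] b o = onSeg-swap p b a o
  onPoly-reverse p a (c ∷ cs) b o with onPoly-++ b (reverse cs) c [] a (subst (λ l → OnPoly p b l a) (ListP.unfold-reverse c cs) o)
  ... | inj₁ o′ = inj₂ (onPoly-reverse p c cs b o′)
  ... | inj₂ o′ = inj₁ (onSeg-swap p c a o′)

  module Underlying (G : SignedGraph) where

    edge : Fin (length (edges G)) → Edge (SignedGraph.n G)
    edge = List.lookup (edges G)

    edge-ordered : ∀ i → Ordered (edge i)
    edge-ordered i = All.lookup (ordered G) (∈-lookup i)

    Joins-irrefl : ∀ {e : Edge (SignedGraph.n G)} {u v} → Ordered e → Joins e u v → u ≢ v
    Joins-irrefl lt (inj₁ refl) refl = ℕP.<-irrefl refl lt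
    Joins-irrefl lt (inj₂ refl) refl = ℕP.<-irrefl refl lt

    underlying : Graph (SignedGraph.n G)
    underlying = record
      { E = λ u v → ∃ λ i → Joins (edge i) u v
      ; E? = λ u v → any? λ i → ≡-dec _≟_ _≟_ (ends (edge i)) (u , v) ⊎-dec ≡-dec _≟_ _≟_ (ends (edge i)) (v , u)
      ; E-sym = λ (i , j) → i , Sum.swap j
      ; E-irrefl = λ (i , j) → Joins-irrefl {edge i} (edge-ordered i) j
      }

    drawn : Planar G → Drawn underlying
    drawn P = record { pos = pos ; arc = arc ; disj = disj }
      where
      open PlaneDrawing P
      arc : ∀ {u v} → E underlying u v → List Point
      arc (i , inj₁ _) = bends i
      arc (i , inj₂ _) = reverse (bends i)
      on : ∀ {u v} p (e : E underlying u v) → OnPoly p (pos u) (arc e) (pos v) → OnArc p (proj₁ e)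
      on p (i , inj₁ refl) o = o
      on p (i , inj₂ refl) o = onPoly-reverse p _ (bends i) _ o
      end : ∀ {u v} w (e : E underlying u v) → IsEnd w (proj₁ e) → w ≡ u ⊎ w ≡ v
      end w (i , inj₁ refl) h = h
      end w (i , inj₂ refl) h = Sum.swap h
      endˡ : ∀ {u v} (e : E underlying u v) → IsEnd u (proj₁ e)
      endˡ (i , inj₁ refl) = inj₁ refl
      endˡ (i , inj₂ refl) = inj₂ refl
      disj : ∀ {u v w z} (e : E underlying u v) (f : E underlying w z) → u ≢ w → u ≢ z → v ≢ w → v ≢ z →
             DisjointArcs (pos u) (arc e) (pos v) (pos w) (arc f) (pos z)
      disj {u} {v} {w} {z} e f u≢w u≢z v≢w v≢z = disjoint λ p o₁ o₂ →
        -- The two indices differ because `u` is an end of the first edge but not of the second.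
        let x , x-e , x-f , _ = no-cross (proj₁ e) (proj₁ f) p (λ i≡j → [ u≢w , u≢z ]′ (end u f (subst (IsEnd u) i≡j (endˡ e)))) (on p e o₁) (on p f o₂)
        in none (end x e x-e) (end x f x-f)
        where
        none : ∀ {x} → x ≡ u ⊎ x ≡ v → x ≡ w ⊎ x ≡ z → ⊥
        none (inj₁ refl) (inj₁ q) = u≢w q
        none (inj₁ refl) (inj₂ q) = u≢z q
        none (inj₂ refl) (inj₁ q) = v≢w q
        none (inj₂ refl) (inj₂ q) = v≢z q

    ∈⇒E : ∀ {u v s} → (u , v , s) ∈ edges G → E underlying u v
    ∈⇒E e∈ = Any.index e∈ , inj₁ (cong ends (sym (AnyP.lookup-index e∈)))

  all-lookup : ∀ {N} {P : ℕ → Set} (t : Vec ℕ N) → (∀ i → P (Vec.lookup t i)) → VAll.All P t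
  all-lookup []      h = []
  all-lookup (_ ∷ t) h = h zero ∷ all-lookup t λ i → h (suc i)

  planar⇒AT≤4 : (G : SignedGraph) → Planar G → Colorable 2 G → AT≤ G 4
  planar⇒AT≤4 G P (φ , proper , φ∈M) = t ,
    coeff≢0 φ (graphPoly G) (value≢0 (edges G)) (edgesPoly-constant (edges G) (All.tabulate λ e∈ → proper e∈)) term ,
    all-lookup t λ w → s≤s (subst (_≤ 3) (count w) (ℕP.≤-trans (unique-length-≤ (unique w) ⊆out) (short O w)))
    where
    open Underlying G
    O = orient (drawn P)
    open Balanced φ (λ v → InM2⇒Unit (φ∈M v))
    open Tails (out O)
    open Choice (choose (edges G) (ordered G) (simple G) (λ e∈ → covers O (∈⇒E e∈)))

-- A planar 2-colorable signed graph that is not 3-choosable.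

module Example where

  open Plane
  open Segments using (onSeg-swap)
  open import Data.Nat as ℕ using (ℕ; suc)
  import Data.Nat.Properties as ℕP
  open import Data.Integer as ℤ using (ℤ; +_; 0ℤ)
  import Data.Integer.Properties as ℤP
  open import Data.Rational as ℚ using (ℚ; 0ℚ; 1ℚ; _+_; _*_; _-_; -_; _<_; _≤_)
  import Data.Rational.Properties as ℚP
  import Data.Sign.Properties as Sign
  open import Data.Sign using (Sign) renaming (+ to plus; - to minus)
  open import Data.Fin using (Fin; suc; toℕ; combine; remQuot; _↑ʳ_)
  open import Data.Fin.Patterns
  open import Data.Fin.Properties as FinP using (_≟_; all?)
  open import Data.Product.Properties using (≡-dec)
  open import Data.List as List using (List; []; _∷_; length; map; concatMap; allFin; tabulate; lookup)
  open import Data.List.Membership.Propositional using (_∈_)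
  open import Data.List.Membership.Propositional.Properties
  open import Data.List.Relation.Unary.Any as Any using (here; there)
  open import Data.List.Relation.Unary.All as All using (All; []; _∷_)
  open import Data.List.Relation.Unary.Unique.DecPropositional using (unique?)
  open import Data.Sum using (_⊎_; inj₁; inj₂; [_,_]′)
  open import Data.Empty using (⊥; ⊥-elim)
  open import Data.Product using (Σ; ∃; _×_; _,_; proj₁; proj₂)
  open import Relation.Binary using (Tri; tri<; tri≈; tri>)
  open import Relation.Nullary using (¬_; Dec; contradiction)
  open import Relation.Nullary.Decidable using (_×-dec_; _⊎-dec_; ¬?; from-yes)
  open import Relation.Binary.PropositionalEquality

  open Q

  -- Two poles, and for each k : Fin 9 two adjacent vertices joined to both poles.
  side : Fin 9 → Fin 2 → Fin 20
  side k s = 2 ↑ʳ combine k s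

  gadget : Fin 9 → List (Edge 20)
  gadget k = (0F , side k 0F , minus) ∷ (0F , side k 1F , minus) ∷ (1F , side k 0F , minus) ∷ (1F , side k 1F , minus)
           ∷ (side k 0F , side k 1F , minus) ∷ []

  G₀ : SignedGraph
  G₀ = record
    { n = 20
    ; edges = concatMap gadget (allFin 9)
    ; ordered = from-yes (All.all? (λ e → toℕ (proj₁ e) ℕ.<? toℕ (proj₁ (proj₂ e))) (concatMap gadget (allFin 9)))
    ; simple = from-yes (unique? (≡-dec _≟_ _≟_) (map ends (concatMap gadget (allFin 9))))
    }

  fromℕ : ℕ → ℚ
  fromℕ k = (+ k) ℚ./ 1

  -- The side vertices lie on a parabola, whose chords separate none of them from the poles.
  place : Fin 20 → Point
  place 0F = fromℕ 9 , fromℕ 1000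
  place 1F = fromℕ 10 , - fromℕ 1000
  place (suc (suc t)) = fromℕ (toℕ t) , fromℕ (toℕ t ℕ.* toℕ t)

  Apart : (a b c d : Point) → Set
  Apart a b c d = 0ℚ < det a b c × 0ℚ < det a b d

  apart? : ∀ a b c d → Dec (Apart a b c d)
  apart? a b c d = 0ℚ ℚP.<? det a b c ×-dec 0ℚ ℚP.<? det a b d

  Noncollinear : (a b c : Point) → Set
  Noncollinear a b c = det a b c ≢ 0ℚ

  noncollinear? : ∀ a b c → Dec (Noncollinear a b c)
  noncollinear? a b c = ¬? (det a b c ℚP.≟ 0ℚ)

  -- Certificates that signs of determinants decide: the two segments share an end and are not
  -- collinear, or one lies strictly on one side of the line through the other.
  Clear : (u v w z : Fin 20) → Set
  Clear u v w z = (u ≡ w × Noncollinear a b d) ⊎ (v ≡ z × Noncollinear b a c) ⊎ (u ≡ z × Noncollinear a b c) ⊎ (v ≡ w × Noncollinear b a d) ⊎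
    Apart a b c d ⊎ Apart b a c d ⊎ Apart c d a b ⊎ Apart d c a b
    where
    a = place u
    b = place v
    c = place w
    d = place z

  clear? : ∀ u v w z → Dec (Clear u v w z)
  clear? u v w z = (u ≟ w ×-dec noncollinear? a b d) ⊎-dec (v ≟ z ×-dec noncollinear? b a c) ⊎-dec
    (u ≟ z ×-dec noncollinear? a b c) ⊎-dec (v ≟ w ×-dec noncollinear? b a d) ⊎-dec
    apart? a b c d ⊎-dec apart? b a c d ⊎-dec apart? c d a b ⊎-dec apart? d c a b
    where
    a = place u
    b = place v
    c = place w
    d = place z

  end₁ end₂ : Fin 45 → Fin 20
  end₁ i = proj₁ (lookup (edges G₀) i)
  end₂ i = proj₁ (proj₂ (lookup (edges G₀) i))

  pairs-clear : ∀ i j → i ≡ j ⊎ Clear (end₁ i) (end₂ i) (end₁ j) (end₂ j)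
  pairs-clear = from-yes (all? λ i → all? λ j → i ≟ j ⊎-dec clear? (end₁ i) (end₂ i) (end₁ j) (end₂ j))

  straight : ∀ i w → (w ≡ end₁ i ⊎ w ≡ end₂ i) ⊎ Noncollinear (place (end₁ i)) (place (end₂ i)) (place w)
  straight = from-yes (all? λ i → all? λ w → (w ≟ end₁ i ⊎-dec w ≟ end₂ i) ⊎-dec noncollinear? (place (end₁ i)) (place (end₂ i)) (place w))

  place-separates : ∀ u v → u ≡ v ⊎ proj₁ (place u) ≢ proj₁ (place v) ⊎ proj₂ (place u) ≢ proj₂ (place v)
  place-separates = from-yes (all? λ u → all? λ v →
    u ≟ v ⊎-dec ¬? (proj₁ (place u) ℚP.≟ proj₁ (place v)) ⊎-dec ¬? (proj₂ (place u) ℚP.≟ proj₂ (place v)))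

  onSeg⇒at : ∀ p a b → OnSeg p a b → ∃ λ t → 0ℚ ≤ t × t ≤ 1ℚ × p ≡ at t a b
  onSeg⇒at p a b (t , l , u , ex , ey) = t , l , u , cong₂ _,_ ex ey

  det-at-ab : ∀ a b t → det a b (at t a b) ≡ 0ℚ
  det-at-ab (ax , ay) (bx , by) t = solve 5 (λ ax ay bx by t →
    :det ax ay bx by (ax :+ t :* (bx :- ax)) (ay :+ t :* (by :- ay)) := con 0ℚ) refl ax ay bx by t

  det-at-ac : ∀ a b c t → det a b (at t a c) ≡ t * det a b c
  det-at-ac (ax , ay) (bx , by) (cx , cy) t = solve 7 (λ ax ay bx by cx cy t →
    :det ax ay bx by (ax :+ t :* (cx :- ax)) (ay :+ t :* (cy :- ay)) := t :* :det ax ay bx by cx cy) refl ax ay bx by cx cy t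

  onSeg⇒collinear : ∀ p a b → OnSeg p a b → det a b p ≡ 0ℚ
  onSeg⇒collinear p a b o = let t , _ , _ , e = onSeg⇒at p a b o in trans (cong (det a b) e) (det-at-ab a b t)

  -- `det a b` vanishes on `ab`; being affine and positive at `c` and `d`, it is positive on all of
  -- `cd`.
  apart⇒disjoint : ∀ a b c d → Apart a b c d → ∀ p → OnSeg p a b → OnSeg p c d → ⊥
  apart⇒disjoint a b c d (x>0 , y>0) p o₁ o₂ = go (onSeg⇒at p c d o₂)
    where
    x = det a b c
    y = det a b d
    positive : ∀ t → 0ℚ ≤ t → t ≤ 1ℚ → 0ℚ < x + t * (y - x)
    positive t t≥0 t≤1 = subst (0ℚ <_) (solve 3 (λ x y t → (con 1ℚ :- t) :* x :+ t :* y := x :+ t :* (y :- x)) refl x y t) (sum (ℚP.<-cmp t 1ℚ))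
      where
      sum : Tri (t < 1ℚ) (t ≡ 1ℚ) (1ℚ < t) → 0ℚ < (1ℚ - t) * x + t * y
      sum (tri< t<1 _ _) = ℚP.+-mono-<-≤ (0<* (p<q⇒0<q-p t<1) x>0)
        (subst (_≤ t * y) (ℚP.*-zeroˡ y) (ℚP.*-monoʳ-≤-nonNeg y {{ℚ.nonNegative (ℚP.<⇒≤ y>0)}} t≥0))
      sum (tri≈ _ refl _) = subst (0ℚ <_) (solve 2 (λ x y → y := (con 1ℚ :- con 1ℚ) :* x :+ con 1ℚ :* y) refl x y) y>0
      sum (tri> _ _ t>1) = contradiction (ℚP.≤-<-trans t≤1 t>1) (ℚP.<-irrefl refl)
    go : _ → ⊥
    go (t , t≥0 , t≤1 , e) = ℚP.<-irrefl (trans (sym (onSeg⇒collinear p a b o₁)) (trans (cong (det a b) e) (det-at a b c d t))) (positive t t≥0 t≤1)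

  -- At parameter `t` on `ac` the determinant is `t * det a b c`, and on `ab` it is 0; hence `t` is
  -- 0.
  noncollinear⇒meet-at : ∀ a b c → Noncollinear a b c → ∀ p → OnSeg p a b → OnSeg p a c → p ≡ a
  noncollinear⇒meet-at a b c abc≢0 p o₁ o₂ = go (onSeg⇒at p a c o₂)
    where
    go : _ → p ≡ a
    go (t , _ , _ , e) = trans e (trans (cong (λ t → at t a c) (*-cancelˡ-≡ {det a b c} abc≢0
      (trans (ℚP.*-comm (det a b c) t) (trans (sym (det-at-ac a b c t)) (trans (cong (det a b) (sym e))
        (trans (onSeg⇒collinear p a b o₁) (sym (ℚP.*-zeroʳ (det a b c))))))))) (at-0 a c))

  G₀-planar : Planar G₀
  G₀-planar = record
    { pos = place
    ; pos-inj = λ u v e → [ (λ p → p) , [ (λ ne → contradiction (cong proj₁ e) ne) , (λ ne → contradiction (cong proj₂ e) ne) ]′ ]′ (place-separates u v)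
    ; bends = λ _ → []
    ; no-cross = λ i j p i≢j o₁ o₂ → [ (λ i≡j → contradiction i≡j i≢j) , (λ h → common i j p o₁ o₂ h) ]′ (pairs-clear i j)
    ; no-pass = λ i w o → [ (λ h → h) , (λ h → contradiction (onSeg⇒collinear (place w) (place (end₁ i)) (place (end₂ i)) o) h) ]′ (straight i w)
    }
    where
    common : ∀ i j p → OnSeg p (place (end₁ i)) (place (end₂ i)) → OnSeg p (place (end₁ j)) (place (end₂ j)) →
      Clear (end₁ i) (end₂ i) (end₁ j) (end₂ j) →
      Σ (Fin 20) λ w → (w ≡ end₁ i ⊎ w ≡ end₂ i) × (w ≡ end₁ j ⊎ w ≡ end₂ j) × p ≡ place w
    common i j p o₁ o₂ = go
      where
      a = place (end₁ i)
      b = place (end₂ i)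
      c = place (end₁ j)
      d = place (end₂ j)
      go : Clear (end₁ i) (end₂ i) (end₁ j) (end₂ j) → _
      go (inj₁ (e , h)) = end₁ i , inj₁ refl , inj₁ e ,
        noncollinear⇒meet-at a b d h p o₁ (subst (λ v → OnSeg p (place v) d) (sym e) o₂)
      go (inj₂ (inj₁ (e , h))) = end₂ i , inj₂ refl , inj₂ e ,
        noncollinear⇒meet-at b a c h p (onSeg-swap p a b o₁) (onSeg-swap p c b (subst (λ v → OnSeg p c (place v)) (sym e) o₂))
      go (inj₂ (inj₂ (inj₁ (e , h)))) = end₁ i , inj₁ refl , inj₂ e ,
        noncollinear⇒meet-at a b c h p o₁ (onSeg-swap p c a (subst (λ v → OnSeg p c (place v)) (sym e) o₂))
      go (inj₂ (inj₂ (inj₂ (inj₁ (e , h))))) = end₂ i , inj₂ refl , inj₁ e ,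
        noncollinear⇒meet-at b a d h p (onSeg-swap p a b o₁) (subst (λ v → OnSeg p (place v) d) (sym e) o₂)
      go (inj₂ (inj₂ (inj₂ (inj₂ (inj₁ h))))) = ⊥-elim (apart⇒disjoint a b c d h p o₁ o₂)
      go (inj₂ (inj₂ (inj₂ (inj₂ (inj₂ (inj₁ h)))))) = ⊥-elim (apart⇒disjoint b a c d h p (onSeg-swap p a b o₁) o₂)
      go (inj₂ (inj₂ (inj₂ (inj₂ (inj₂ (inj₂ (inj₁ h))))))) = ⊥-elim (apart⇒disjoint c d a b h p o₂ o₁)
      go (inj₂ (inj₂ (inj₂ (inj₂ (inj₂ (inj₂ (inj₂ h))))))) = ⊥-elim (apart⇒disjoint d c a b h p (onSeg-swap p c d o₂) o₁)

  all-minus : All (λ e → proj₂ (proj₂ e) ≡ minus) (edges G₀)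
  all-minus = from-yes (All.all? (λ e → proj₂ (proj₂ e) Sign.≟ minus) (edges G₀))

  G₀-2-colorable : Colorable 2 G₀
  G₀-2-colorable = (λ _ → + 1) , proper , λ _ → inj₁ (λ ()) , ℕP.≤-refl
    where
    proper : Proper G₀ λ _ → + 1
    proper e∈ eq with All.lookup all-minus e∈
    proper _ () | refl

  -- The colours 1, 2, 3 and 4, 5, 6: non-zero and disjoint, so that every list built from -p, -q
  -- and 0 has three elements.
  poleColor : Fin 2 → Fin 3 → ℤ
  poleColor 0F i = + (1 ℕ.+ toℕ i)
  poleColor 1F i = + (4 ℕ.+ toℕ i)

  -- The two side vertices of gadget k are blocked by the k-th pair of pole colours.
  sideList : Fin 9 → List ℤ
  sideList k = ℤ.- poleColor 0F (proj₁ (remQuot 3 k)) ∷ ℤ.- poleColor 1F (proj₂ (remQuot {3} 3 k)) ∷ 0ℤ ∷ []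

  lists : Fin 20 → List ℤ
  lists 0F = tabulate (poleColor 0F)
  lists 1F = tabulate (poleColor 1F)
  lists (suc (suc t)) = sideList (proj₁ (remQuot 2 t))

  lists-3 : IsListAssignment G₀ 3 lists
  lists-3 = from-yes (all? λ v → length (lists v) ℕP.≟ 3 ×-dec unique? ℤP._≟_ (lists v))

  module _ (φ : Fin 20 → ℤ) (proper : Proper G₀ φ) (φ∈ : ∀ v → φ v ∈ lists v) where

    -- Along the negative edges to the poles, the colour -p conflicts with one pole and -q with the
    -- other. Both side vertices are left with 0, and the negative edge between them forbids this.
    blocked : ∀ i j → φ 0F ≡ poleColor 0F i → φ 1F ≡ poleColor 1F j → ⊥
    blocked i j e₀ e₁ = proper (edge∈ (there (there (there (there (here refl))))))
        (trans (zero-at 0F (edge∈ (here refl)) (edge∈ (there (there (here refl)))))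
          (sym (cong ℤ.-_ (zero-at 1F (edge∈ (there (here refl))) (edge∈ (there (there (there (here refl)))))))))
      where
      k = combine i j
      edge∈ : ∀ {e} → e ∈ gadget k → e ∈ edges G₀
      edge∈ e∈ = ∈-concatMap⁺ gadget {xs = allFin 9} (Any.map (λ { refl → e∈ }) (∈-allFin k))
      list-side : ∀ s → lists (side k s) ≡ ℤ.- poleColor 0F i ∷ ℤ.- poleColor 1F j ∷ 0ℤ ∷ []
      list-side s = trans (cong (λ (k′ , _) → sideList k′) (FinP.remQuot-combine k s))
        (cong (λ (i′ , j′) → ℤ.- poleColor 0F i′ ∷ ℤ.- poleColor 1F j′ ∷ 0ℤ ∷ []) (FinP.remQuot-combine i j))
      zero-at : ∀ s → (0F , side k s , minus) ∈ edges G₀ → (1F , side k s , minus) ∈ edges G₀ → φ (side k s) ≡ 0ℤ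
      zero-at s e∈₀ e∈₁ with subst (φ (side k s) ∈_) (list-side s) (φ∈ (side k s))
      ... | here e = contradiction (trans e₀ (sym (trans (cong ℤ.-_ e) (ℤP.neg-involutive (poleColor 0F i))))) (proper e∈₀)
      ... | there (here e) = contradiction (trans e₁ (sym (trans (cong ℤ.-_ e) (ℤP.neg-involutive (poleColor 1F j))))) (proper e∈₁)
      ... | there (there (here e)) = e

    no-list-coloring : ⊥
    no-list-coloring = let i , e₀ = ∈-tabulate⁻ {f = poleColor 0F} (φ∈ 0F) ; j , e₁ = ∈-tabulate⁻ {f = poleColor 1F} (φ∈ 1F) in blocked i j e₀ e₁

  G₀-not-3-choosable : ¬ Choosable 3 G₀
  G₀-not-3-choosable choosable = let φ , proper , φ∈ = choosable lists lists-3 in no-list-coloring φ proper φ∈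

open Coefficients using (planar⇒AT≤4)
open Example using (G₀; G₀-planar; G₀-2-colorable; G₀-not-3-choosable)

theorem1p5 : ((G : SignedGraph) → Planar G → Colorable 2 G → AT≤ G 4)
    × Σ SignedGraph (λ G → Planar G × Colorable 2 G × ¬ Choosable 3 G)
theorem1p5 = planar⇒AT≤4 , G₀ , G₀-planar , G₀-2-colorable , G₀-not-3-choosable
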